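{- Let $G$ be a finite group and let $S$ be a $2$-separable generating set of $G$ with $1\in S$, $|S|\ge 3$ and $|G|\ge 2\alpha_2(S)+\kappa_2(S)$. Let $A$ be a $2$-atom of $S$ with $|A|\ge 3$. If $A$ is not left-periodic, then $|A|\le \kappa_2(S)-|S|+3$.
   Context: Let $G$ be a finite group and $S$ a generating subset of $G$ containing $1$. For $X\subseteq G$ put $\partial X=XS\setminus X$ and $X^*=G\setminus (X\cup\partial X)=G\setminus XS$. For $k\ge 1$, $S$ is $k$-separable if there is $X\subseteq G$ with $|X|\ge k$ and $|X^*|\ge k$. If $S$ is $k$-separable, $\kappa_k(S)=\min\{|\partial X| : |X|\ge k,\ |X^*|\ge k\}$; a set $X$ with $|X|\ge k$, $|X^*|\ge k$ achieving this minimum is a $k$-fragment of $S$; a $k$-fragment of minimum cardinality is a $k$-atom of $S$; $\alpha_k(S)$ is the cardinality of a $k$-atom of $S$. A set $A\subseteq G$ is left-periodic if there is $x\in G$, $x\ne 1$, with $xA=A$. -}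

module Defs where

open import Algebra.Bundles using (Group)
open import Data.Fin.Base using (Fin)
open import Data.Fin.Properties using (any?; _≟_)
open import Data.Fin.Subset using (Subset; _∈_; _∪_; _─_; ∁; ∣_∣)
open import Data.Fin.Subset.Properties using (_∈?_; anySubset?)
open import Data.Nat.Base using (ℕ; _≤_; _<_)
open import Data.Nat.Induction using (<-wellFounded)
open import Data.Nat.Properties as ℕ using (_≤?_; _<?_; ≮⇒≥)
open import Data.Product.Base using (∃; _×_; _,_; proj₁; proj₂)
open import Data.Vec.Base using (tabulate)
open import Function.Bundles using (Inverse)
open import Induction.WellFounded using (Acc; acc)
open import Level using (Level; suc; _⊔_)
open import Relation.Binary.PropositionalEquality using (_≡_; refl; setoid)
open import Relation.Nullary using (¬_; does; yes; no; _×-dec_)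
open import Relation.Unary using (Pred; Decidable)

IsMinimiser : ∀ {n p} → Pred (Subset n) p → (Subset n → ℕ) → Pred (Subset n) p
IsMinimiser P f X = P X × (∀ Y → P Y → f X ≤ f Y)

minimiser : ∀ {n p} {P : Pred (Subset n) p} → Decidable P →
            (f : Subset n → ℕ) → ∃ P → ∃ (IsMinimiser P f)
minimiser {n} {p} {P} P? f (X₀ , PX₀) = descend X₀ PX₀ (<-wellFounded (f X₀))
  where
  descend : ∀ X → P X → Acc _<_ (f X) → ∃ (IsMinimiser P f)
  descend X PX (acc smaller) with anySubset? (λ Y → P? Y ×-dec (f Y <? f X))
  ... | yes (Y , PY , fY<fX) = descend Y PY (smaller fY<fX)
  ... | no  none             = X , PX , λ Y PY → ≮⇒≥ (λ fY<fX → none (Y , PY , fY<fX))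

record FiniteGroup (c ℓ : Level) : Set (suc (c ⊔ ℓ)) where
  field
    group       : Group c ℓ
    order       : ℕ
    enumeration : Inverse (Group.setoid group) (setoid (Fin order))

  open Group group public
  open Inverse enumeration public using () renaming (to to index; from to element)

-- Subsets of G are sets of indices, so that they have a cardinality and
-- propositional equality of subsets is extensional.
module _ {c ℓ : Level} (G : FiniteGroup c ℓ) where

  open FiniteGroup G using (Carrier; _≈_; _∙_; ε; _⁻¹; order; index; element)

  GSubset : Set
  GSubset = Subset order

  infix 4 _∈ᴳ_
  _∈ᴳ_ : Carrier → GSubset → Set
  x ∈ᴳ X = index x ∈ X

  -- X Y = { x ∙ y ∣ x ∈ X, y ∈ Y }
  productSet : GSubset → GSubset → GSubset
  productSet X Y = tabulate λ g → does
    (any? λ i → any? λ j →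
      (i ∈? X) ×-dec (j ∈? Y) ×-dec (g ≟ index (element i ∙ element j)))

  -- x A = { x ∙ a ∣ a ∈ A }
  leftTranslate : Carrier → GSubset → GSubset
  leftTranslate x A = tabulate λ g → does
    (any? λ i → (i ∈? A) ×-dec (g ≟ index (x ∙ element i)))

  LeftPeriodic : GSubset → Set (c ⊔ ℓ)
  LeftPeriodic A = ∃ λ x → ¬ (x ≈ ε) × leftTranslate x A ≡ A

  data ⟨_⟩ (S : GSubset) : Pred Carrier (c ⊔ ℓ) where
    ⟨⟩-gen  : ∀ {x} → x ∈ᴳ S → ⟨ S ⟩ x
    ⟨⟩-ε    : ⟨ S ⟩ ε
    ⟨⟩-∙    : ∀ {x y} → ⟨ S ⟩ x → ⟨ S ⟩ y → ⟨ S ⟩ (x ∙ y)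
    ⟨⟩-⁻¹   : ∀ {x} → ⟨ S ⟩ x → ⟨ S ⟩ (x ⁻¹)
    ⟨⟩-resp : ∀ {x y} → x ≈ y → ⟨ S ⟩ x → ⟨ S ⟩ y

  Generates : GSubset → Set (c ⊔ ℓ)
  Generates S = ∀ x → ⟨ S ⟩ x

  ∂ : GSubset → GSubset → GSubset
  ∂ S X = productSet X S ─ X

  -- X* = G ∖ (X ∪ ∂X)
  exterior : GSubset → GSubset → GSubset
  exterior S X = ∁ (X ∪ ∂ S X)

  Separates : ℕ → GSubset → GSubset → Set
  Separates k S X = k ≤ ∣ X ∣ × k ≤ ∣ exterior S X ∣

  separates? : ∀ k S → Decidable (Separates k S)
  separates? k S X = (k ≤? ∣ X ∣) ×-dec (k ≤? ∣ exterior S X ∣)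

  Separable : ℕ → GSubset → Set
  Separable k S = ∃ (Separates k S)

  module _ (k : ℕ) (S : GSubset) (sep : Separable k S) where

    ∂-minimiser : ∃ (IsMinimiser (Separates k S) (λ X → ∣ ∂ S X ∣))
    ∂-minimiser = minimiser (separates? k S) (λ X → ∣ ∂ S X ∣) sep

    κ : ℕ
    κ = ∣ ∂ S (proj₁ ∂-minimiser) ∣

    IsFragment : GSubset → Set
    IsFragment X = Separates k S X × ∣ ∂ S X ∣ ≡ κ

    isFragment? : Decidable IsFragment
    isFragment? X = separates? k S X ×-dec (∣ ∂ S X ∣ ℕ.≟ κ)

    IsAtom : GSubset → Set
    IsAtom = IsMinimiser IsFragment ∣_∣

    atom : ∃ IsAtom
    atom = minimiser isFragment? ∣_∣
             (proj₁ ∂-minimiser , proj₁ (proj₂ ∂-minimiser) , refl)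

    α : ℕ
    α = ∣ proj₁ atom ∣

{-# OPTIONS --safe #-}
module Submission where

-- Write AX and XS for product sets, a = |A| and κ = κ₂(S).  Since |AS| = a + κ, the claim
-- a ≤ κ - |S| + 3 says that |AS| - |S| ≥ 2a - 3, where 2a - 3 is a lower bound for
-- |AX| - |X| on pairs X when distinct right translates of A meet in at most one
-- element.  The roles of A and S are therefore exchanged: A acts on S from the left, and
-- the isoperimetric method is applied to A.
--
-- The atom A is translated so that 1 ∈ A.  By submodularity of X ↦ |XS| and the bound on
-- |G|, two distinct translates gA meet in at most one element (atom-sidon), so A is a
-- Sidon set, and so is A⁻¹; distinct right translates Ax also meet in at most one element.
-- As A without a point is not a fragment, every s ∈ S has a representation s = b s′ with
-- b ∈ A and s′ ≠ s (second-representation).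
--
-- Let W be the subgroup generated by A.  The core (admissible⇒large) is that |AX| ≥ |X| + 2a - 3
-- for X ⊆ W with |X| ≥ 2 and |W| ≥ |AX| + 2.  In a counterexample with |AX| - |X| and then
-- |X| minimal, over all Sidon sets of size a generating W, the set X plays the part of an atom:
-- comparison with the complement of AX under A⁻¹ gives |W| ≥ |X| + |AX| (room-X), and then
-- |X ∩ Xg| ≥ 2 forces Xg = X (two-common⇒periodic).  Let H be the right stabiliser of X.
-- Two translates xX, yX with x ≠ y in A meet in at most |H| elements, X and AX are unions of
-- left cosets of H, and AX contains X and a further coset.  Counting four translates Ax and
-- three translates xX leaves only |X| = 2|H|, |AX| = 3|H| (shape).  If |H| = 2 then its
-- nontrivial element z is an involution, so that Ax and Axz are disjoint, and three
-- translates of A are too large for AX.  If |H| ≥ 3 then a ≥ 4, and four 2-coset sets xX that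
-- pairwise share at most one coset do not fit in three cosets.
--
-- For the theorem (atom-large) S is cut along the right cosets Wx, each of which is preserved
-- by A.  If WS = AS then W has boundary at most κ, so that W = A is periodic.  Otherwise
-- some Wx meeting S is not covered by AS.  There T = S ∩ Wx has at least two
-- elements, and either the core applies to T, or |T| + a ≤ |W| ≤ |AT| + 1.  In the
-- latter case either a second coset has a deficiency and contributes a - 1 more (excess), or
-- |WS| ≤ |AS| + 1, and then |W| ≤ a + 1 contradicts |T| + a ≤ |W|.

open import Defs
open import Algebra.Bundles using (Group)
import Algebra.Properties.Group as GroupProperties
open import Algebra.Structures using (IsGroup)
open import Data.Empty using (⊥; ⊥-elim)
open import Data.Fin.Base using (Fin; zero; suc)
open import Data.Fin.Properties using (suc-injective; _≟_; any?)
open import Data.Fin.Subset using (Subset; inside; outside; _∈_; _∉_; _⊆_; _∪_; _∩_; _─_; _-_; ∁; ⁅_⁆; ⊤)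
open import Data.Fin.Subset using (∣_∣)
open import Data.Fin.Subset.Properties
open import Data.Integer.Base as ℤ using (+_)
import Data.Integer.Properties as ℤ
open import Data.List.Base using (List; []; _∷_; length)
open import Data.List.Relation.Unary.All using (All; []; _∷_)
open import Data.Nat.Base using (ℕ; zero; suc; _<_; z≤n; s≤s)
open import Data.Nat.Base using (_+_; _*_; _≤_; _≥_)
open import Data.Nat.Properties using
  (≤-trans; ≤-refl; ≤-reflexive; ≤-antisym; ≤-pred; <⇒≱; ≰⇒>; _≤?_; m≤m+n; m≤n+m; m∸n+n≡m
  ; +-suc; +-comm; +-assoc; +-identityʳ; +-mono-≤; +-monoˡ-≤; +-monoʳ-≤; +-cancelˡ-≤; +-cancelʳ-≤
  ; *-monoʳ-≤; *-cancelˡ-≤; *-cancelʳ-≤; *-cancelˡ-<; *-cancelʳ-<; module ≤-Reasoning)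
open import Data.Nat.Tactic.RingSolver using (solve-∀)
open import Data.Product.Base using (∃; _×_; _,_; proj₁; proj₂)
open import Data.Sum.Base using (_⊎_; inj₁; inj₂; [_,_]′)
open import Data.Vec.Base using ([]; _∷_; here; there; tabulate)
open import Data.Vec.Properties using (lookup∘tabulate; lookup⇒[]=; []=⇒lookup)
open import Function.Base using (_∘_; case_of_)
open import Function.Bundles using (Inverse)
open import Level using (Level)
open import Relation.Binary.PropositionalEquality using
  (_≡_; _≢_; refl; sym; trans; cong; cong₂
  ; subst; isEquivalence; module ≡-Reasoning)
open import Relation.Nullary using (¬_; Dec; yes; no; does; contradiction; ¬?; _×-dec_)
open import Relation.Nullary.Decidable using (dec-true)

private
  variable
    m n : ℕ

-- Cardinalities of finite subsets

-- The subset of Fin n cut out by a decidable predicate.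
select : {P : Fin n → Set} → (∀ i → Dec (P i)) → Subset n
select P? = tabulate (λ i → does (P? i))

∈-select⁺ : {P : Fin n → Set} (P? : ∀ i → Dec (P i)) {i : Fin n} → P i → i ∈ select P?
∈-select⁺ P? {i} p =
  lookup⇒[]= i _ (trans (lookup∘tabulate _ i) (dec-true (P? i) p))

∈-select⁻ : {P : Fin n → Set} (P? : ∀ i → Dec (P i)) {i : Fin n} → i ∈ select P? → P i
∈-select⁻ P? {i} i∈ with P? i | trans (sym (lookup∘tabulate (λ j → does (P? j)) i)) ([]=⇒lookup i∈)
... | yes p | _ = p
... | no _  | ()

x∈p─q⇒x∉q : (p q : Subset n) {x : Fin n} → x ∈ p ─ q → x ∉ q
x∈p─q⇒x∉q (_ ∷ p) (outside ∷ q) here      ()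
x∈p─q⇒x∉q (_ ∷ p) (inside ∷ q)  ()        here
x∈p─q⇒x∉q (_ ∷ p) (_ ∷ q)       (there i) (there j) = x∈p─q⇒x∉q p q i j

p─q⁻ : (p q : Subset n) {x : Fin n} → x ∈ p ─ q → x ∈ p × x ∉ q
p─q⁻ p q x∈ = p─q⊆p p q x∈ , x∈p─q⇒x∉q p q x∈

⊆-or-∃ : (p q : Subset n) → p ⊆ q ⊎ (∃ λ x → x ∈ p × x ∉ q)
⊆-or-∃ p q with any? (λ x → (x ∈? p) ×-dec ¬? (x ∈? q))
... | yes (x , x∈p , x∉q) = inj₂ (x , x∈p , x∉q)
... | no none = inj₁ sub
  where
  sub : p ⊆ q
  sub {x} x∈p with x ∈? q
  ... | yes x∈q = x∈q
  ... | no  x∉q = contradiction (x , x∈p , x∉q) none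

∣∣-injective-≤ : (X : Subset m) (Y : Subset n) (f : Fin m → Fin n) →
                 (∀ {i} → i ∈ X → f i ∈ Y) →
                 (∀ {i j} → f i ≡ f j → i ≡ j) →
                 ∣ X ∣ ≤ ∣ Y ∣
∣∣-injective-≤ []            Y f f∈ inj = z≤n
∣∣-injective-≤ (outside ∷ X) Y f f∈ inj =
  ∣∣-injective-≤ X Y (f ∘ suc) (f∈ ∘ there) (suc-injective ∘ inj)
∣∣-injective-≤ (inside ∷ X)  Y f f∈ inj = ≤-trans
  (s≤s (∣∣-injective-≤ X (Y - f zero) (f ∘ suc)
    (λ i∈ → x∈p∧x≢y⇒x∈p-y (f∈ (there i∈)) (λ eq → case inj eq of λ ()))
    (suc-injective ∘ inj)))
  (x∈p⇒∣p-x∣<∣p∣ (f∈ here))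

∣∪∣+∣∩∣ : (p q : Subset n) → ∣ p ∪ q ∣ + ∣ p ∩ q ∣ ≡ ∣ p ∣ + ∣ q ∣
∣∪∣+∣∩∣ []            []            = refl
∣∪∣+∣∩∣ (inside ∷ p)  (inside ∷ q)  = cong suc
  (trans (+-suc _ _) (trans (cong suc (∣∪∣+∣∩∣ p q)) (sym (+-suc _ _))))
∣∪∣+∣∩∣ (inside ∷ p)  (outside ∷ q) = cong suc (∣∪∣+∣∩∣ p q)
∣∪∣+∣∩∣ (outside ∷ p) (inside ∷ q)  = trans (cong suc (∣∪∣+∣∩∣ p q)) (sym (+-suc _ _))
∣∪∣+∣∩∣ (outside ∷ p) (outside ∷ q) = ∣∪∣+∣∩∣ p q

∪-least : {p q r : Subset n} → p ⊆ r → q ⊆ r → p ∪ q ⊆ r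
∪-least {p = p} {q} p⊆r q⊆r x∈ = [ p⊆r , q⊆r ]′ (x∈p∪q⁻ p q x∈)

inclusion-exclusion₂ : (p q r : Subset n) → p ⊆ r → q ⊆ r → ∣ p ∣ + ∣ q ∣ ≤ ∣ r ∣ + ∣ p ∩ q ∣
inclusion-exclusion₂ p q r p⊆r q⊆r = ≤-trans (≤-reflexive (sym (∣∪∣+∣∩∣ p q)))
  (+-monoˡ-≤ ∣ p ∩ q ∣ (p⊆q⇒∣p∣≤∣q∣ {p = p ∪ q} {q = r} (∪-least p⊆r q⊆r)))

∣∣≡0 : (p : Subset n) → (∀ {x} → x ∉ p) → ∣ p ∣ ≡ 0
∣∣≡0 {n} p none = trans (cong ∣_∣ (Empty-unique {p = p} (λ (_ , x∈) → none x∈))) (∣⊥∣≡0 n)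

disjoint-≤ : (p q r : Subset n) → p ⊆ r → q ⊆ r → (∀ {x} → x ∈ p → x ∉ q) →
             ∣ p ∣ + ∣ q ∣ ≤ ∣ r ∣
disjoint-≤ p q r p⊆r q⊆r dis = ≤-trans (inclusion-exclusion₂ p q r p⊆r q⊆r)
  (≤-reflexive (trans (cong (_+_ (∣ r ∣)) (∣∣≡0 (p ∩ q)
    (λ x∈ → let (a , b) = x∈p∩q⁻ p q x∈ in dis a b))) (+-identityʳ _)))

∣∪∣≤ : (p q : Subset n) → ∣ p ∪ q ∣ ≤ ∣ p ∣ + ∣ q ∣
∣∪∣≤ p q = ≤-trans (m≤m+n _ _) (≤-reflexive (∣∪∣+∣∩∣ p q))

cover-≤ : (p q r : Subset n) → (∀ {x} → x ∈ r → x ∈ p ⊎ x ∈ q) → ∣ r ∣ ≤ ∣ p ∣ + ∣ q ∣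
cover-≤ p q r cov = ≤-trans (p⊆q⇒∣p∣≤∣q∣ {p = r} {q = p ∪ q} (λ x∈ → x∈p∪q⁺ (cov x∈))) (∣∪∣≤ p q)

split-∣∣ : (p q : Subset n) → ∣ p ∩ q ∣ + ∣ p ─ q ∣ ≡ ∣ p ∣
split-∣∣ p q = ≤-antisym
  (disjoint-≤ (p ∩ q) (p ─ q) p (p∩q⊆p p q) (p─q⊆p p q)
    (λ x∈∩ x∈─ → x∈p─q⇒x∉q p q x∈─ (proj₂ (x∈p∩q⁻ p q x∈∩))))
  (cover-≤ (p ∩ q) (p ─ q) p λ {x} x∈p → case x ∈? q of λ where
    (yes x∈q) → inj₁ (x∈p∩q⁺ (x∈p , x∈q))
    (no  x∉q) → inj₂ (x∈p∧x∉q⇒x∈p─q x∈p x∉q))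

∣─∣ : (p q : Subset n) → q ⊆ p → ∣ q ∣ + ∣ p ─ q ∣ ≡ ∣ p ∣
∣─∣ p q q⊆p = trans
  (cong (λ s → ∣ s ∣ + ∣ p ─ q ∣) (⊆-antisym (λ x∈ → x∈p∩q⁺ (q⊆p x∈ , x∈)) (p∩q⊆q p q)))
  (split-∣∣ p q)

⊆∧∣∣≥⇒⊇ : {p q : Subset n} → p ⊆ q → ∣ q ∣ ≤ ∣ p ∣ → q ⊆ p
⊆∧∣∣≥⇒⊇ {p = p} {q} p⊆q q≤p {x} x∈q with x ∈? p
... | yes x∈p = x∈p
... | no  x∉p = contradiction q≤p (<⇒≱ (p⊂q⇒∣p∣<∣q∣ (p⊆q , x , x∈q , x∉p)))

∣p∣≤1+∣p-x∣ : (p : Subset n) (x : Fin n) → ∣ p ∣ ≤ suc ∣ p - x ∣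
∣p∣≤1+∣p-x∣ p x = ≤-trans (≤-reflexive (sym (split-∣∣ p ⁅ x ⁆)))
  (+-monoˡ-≤ ∣ p - x ∣ (≤-trans (∣p∩q∣≤∣q∣ p ⁅ x ⁆) (≤-reflexive (∣⁅x⁆∣≡1 x))))

-- A set with more elements than a list has an element outside the list.  The proof is
-- abstract because its normal form on explicit lists is large.
abstract
  fresh : (p : Subset n) (xs : List (Fin n)) → length xs < ∣ p ∣ →
          ∃ λ y → y ∈ p × All (y ≢_) xs
  fresh p [] 0<p with nonempty? p
  ... | yes (y , y∈p) = y , y∈p , []
  ... | no empty = contradiction 0<p (λ lt → case ≤-trans lt (≤-reflexive (∣∣≡0 p (λ {x} x∈ → empty (x , x∈)))) of λ ())
  fresh p (x ∷ xs) lt =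
    let y , y∈ , y∉xs = fresh (p - x) xs (≤-pred (≤-trans lt (∣p∣≤1+∣p-x∣ p x)))
        y∈p , y∉x = p─q⁻ p ⁅ x ⁆ y∈
    in y , y∈p , x∉⁅y⁆⇒x≢y y∉x ∷ y∉xs

∣∣≤1 : (p : Subset n) → (∀ {x y} → x ∈ p → y ∈ p → x ≡ y) → ∣ p ∣ ≤ 1
∣∣≤1 p all-equal with ∣ p ∣ ≤? 1
... | yes p≤1 = p≤1
... | no  p≰1 with fresh p [] (≤-trans (s≤s z≤n) (≰⇒> p≰1))
...   | x , x∈ , _ with fresh p (x ∷ []) (≰⇒> p≰1)
...     | y , y∈ , y≢x ∷ [] = contradiction (all-equal y∈ x∈) y≢x

1≤∣∣ : {p : Subset n} {x : Fin n} → x ∈ p → 1 ≤ ∣ p ∣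
1≤∣∣ x∈p = ≤-trans (s≤s z≤n) (x∈p⇒∣p-x∣<∣p∣ x∈p)

2≤∣∣ : {p : Subset n} {x y : Fin n} → x ∈ p → y ∈ p → x ≢ y → 2 ≤ ∣ p ∣
2≤∣∣ x∈p y∈p x≢y = ≤-trans (s≤s (1≤∣∣ (x∈p∧x≢y⇒x∈p-y x∈p x≢y))) (x∈p⇒∣p-x∣<∣p∣ y∈p)

3≤∣∣ : {p : Subset n} {x y z : Fin n} → x ∈ p → y ∈ p → z ∈ p →
       x ≢ y → x ≢ z → y ≢ z → 3 ≤ ∣ p ∣
3≤∣∣ x∈p y∈p z∈p x≢y x≢z y≢z =
  ≤-trans (s≤s (2≤∣∣ (x∈p∧x≢y⇒x∈p-y x∈p x≢z) (x∈p∧x≢y⇒x∈p-y y∈p y≢z) x≢y)) (x∈p⇒∣p-x∣<∣p∣ z∈p)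

-- Linear arithmetic by certificate: l ≤ r follows from L ≤ R when r - l = (R - L) + k.  Here
-- L ≤ R is a sum of known inequalities.
linear : {L R l r : ℕ} (k : ℕ) → L ≤ R → l + R + k ≡ r + L → l ≤ r
linear {L} {R} {l} {r} k L≤R eq = +-cancelʳ-≤ R l r (begin
  l + R     ≤⟨ m≤m+n (l + R) k ⟩
  l + R + k ≡⟨ eq ⟩
  r + L     ≤⟨ +-monoʳ-≤ r L≤R ⟩
  r + R     ∎)
  where open ≤-Reasoning

-- The refutation of L ≤ R when L > R.
infeasible : {L R : ℕ} (k : ℕ) → L ≤ R → suc (R + k) ≡ L → ⊥
infeasible k L≤R eq = <⇒≱ (≤-trans (s≤s (m≤m+n _ k)) (≤-reflexive eq)) L≤R

∣∪∩∣≤ : (p q s : Subset n) → ∣ (p ∪ q) ∩ s ∣ ≤ ∣ p ∩ s ∣ + ∣ q ∩ s ∣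
∣∪∩∣≤ p q s = cover-≤ (p ∩ s) (q ∩ s) ((p ∪ q) ∩ s) λ x∈ →
  let x∈pq , x∈s = x∈p∩q⁻ (p ∪ q) s x∈ in
  case x∈p∪q⁻ p q x∈pq of λ where
    (inj₁ x∈p) → inj₁ (x∈p∩q⁺ (x∈p , x∈s))
    (inj₂ x∈q) → inj₂ (x∈p∩q⁺ (x∈q , x∈s))

inclusion-exclusion₃ : (p q s r : Subset n) {c₁ c₂ c₃ : ℕ} →
  p ⊆ r → q ⊆ r → s ⊆ r → ∣ p ∩ q ∣ ≤ c₁ → ∣ p ∩ s ∣ ≤ c₂ → ∣ q ∩ s ∣ ≤ c₃ →
  ∣ p ∣ + ∣ q ∣ + ∣ s ∣ ≤ ∣ r ∣ + (c₁ + c₂ + c₃)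
inclusion-exclusion₃ p q s r {c₁} {c₂} {c₃} p⊆ q⊆ s⊆ pq ps qs =
  linear 0
    (+-mono-≤ (+-mono-≤ pq (+-mono-≤ ps qs))
      (+-mono-≤ (≤-reflexive (sym (∣∪∣+∣∩∣ p q)))
      (+-mono-≤ (inclusion-exclusion₂ (p ∪ q) s r (∪-least p⊆ q⊆) s⊆) (∣∪∩∣≤ p q s))))
    (arith (∣ p ∣) (∣ q ∣) (∣ s ∣) (∣ r ∣) (∣ p ∪ q ∣) (∣ p ∩ q ∣) (∣ p ∩ s ∣) (∣ q ∩ s ∣) (∣ (p ∪ q) ∩ s ∣) c₁ c₂ c₃)
  where
  arith : ∀ P Q S R PuQ PQ PS QS M c₁ c₂ c₃ →
    P + Q + S + (c₁ + (c₂ + c₃) + (PuQ + PQ + (R + M + (PS + QS)))) + 0 ≡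
    R + (c₁ + c₂ + c₃) + (PQ + (PS + QS) + (P + Q + (PuQ + S + M)))
  arith = solve-∀

inclusion-exclusion₄ : (p q s t r : Subset n) (c : ℕ) →
  p ⊆ r → q ⊆ r → s ⊆ r → t ⊆ r →
  ∣ p ∩ q ∣ ≤ c → ∣ p ∩ s ∣ ≤ c → ∣ q ∩ s ∣ ≤ c →
  ∣ p ∩ t ∣ ≤ c → ∣ q ∩ t ∣ ≤ c → ∣ s ∩ t ∣ ≤ c →
  ∣ p ∣ + ∣ q ∣ + ∣ s ∣ + ∣ t ∣ ≤ ∣ r ∣ + 6 * c
inclusion-exclusion₄ p q s t r c p⊆ q⊆ s⊆ t⊆ pq ps qs pt qt st =
  linear 0
    (+-mono-≤ (inclusion-exclusion₃ p q s u (p⊆p∪q (q ∪ s)) (λ x∈ → q⊆p∪q p (q ∪ s) (p⊆p∪q s x∈))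
                (λ x∈ → q⊆p∪q p (q ∪ s) (q⊆p∪q q s x∈)) pq ps qs)
      (+-mono-≤ (inclusion-exclusion₂ u t r (∪-least p⊆ (∪-least q⊆ s⊆)) t⊆)
        (+-mono-≤ (∣∪∩∣≤ p (q ∪ s) t) (+-mono-≤ (∣∪∩∣≤ q s t) (+-mono-≤ pt (+-mono-≤ qt st))))))
    (arith (∣ p ∣) (∣ q ∣) (∣ s ∣) (∣ t ∣) (∣ r ∣) (∣ u ∣) (∣ u ∩ t ∣) (∣ (q ∪ s) ∩ t ∣)
           (∣ p ∩ t ∣) (∣ q ∩ t ∣) (∣ s ∩ t ∣) c)
  where
  u = p ∪ (q ∪ s)
  arith : ∀ P Q S T R U UT V PT QT ST c →
    P + Q + S + T + (U + (c + c + c) + (R + UT + (PT + V + (QT + ST + (c + (c + c)))))) + 0 ≡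
    R + 6 * c + (P + Q + S + (U + T + (UT + (V + (PT + (QT + ST))))))
  arith = solve-∀

times₂ : (m : ℕ) {a b k : ℕ} → a ≡ m → b ≡ m → a + b ≤ k → 2 * m ≤ k
times₂ m refl refl = ≤-trans (≤-reflexive (arith m))
  where
  arith : ∀ m → 2 * m ≡ m + m
  arith = solve-∀

times₃ : (m : ℕ) {a b c k : ℕ} → a ≡ m → b ≡ m → c ≡ m → a + b + c ≤ k → 3 * m ≤ k
times₃ m refl refl refl = ≤-trans (≤-reflexive (arith m))
  where
  arith : ∀ m → 3 * m ≡ m + m + m
  arith = solve-∀

times₄ : (m : ℕ) {a b c d k : ℕ} → a ≡ m → b ≡ m → c ≡ m → d ≡ m → a + b + c + d ≤ k → 4 * m ≤ k
times₄ m refl refl refl refl = ≤-trans (≤-reflexive (arith m))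
  where
  arith : ∀ m → 4 * m ≡ m + m + m + m
  arith = solve-∀

-- Two, three, four distinct elements of the set p.
Distinct₂ Distinct₃ Distinct₄ : Subset n → Set
Distinct₂ p = ∃ λ x → ∃ λ y → (x ∈ p × y ∈ p) × y ≢ x
Distinct₃ p = ∃ λ x → ∃ λ y → ∃ λ z → (x ∈ p × y ∈ p × z ∈ p) × y ≢ x × z ≢ x × z ≢ y
Distinct₄ p = ∃ λ x → ∃ λ y → ∃ λ z → ∃ λ w → (x ∈ p × y ∈ p × z ∈ p × w ∈ p) ×
  y ≢ x × z ≢ x × z ≢ y × w ≢ x × w ≢ y × w ≢ z

distinct₂ : (p : Subset n) → 2 ≤ ∣ p ∣ → Distinct₂ p
distinct₂ p 2≤ with fresh p [] (≤-trans (s≤s z≤n) 2≤)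
... | x , x∈ , _ with fresh p (x ∷ []) 2≤
... | y , y∈ , y≢x ∷ [] = x , y , (x∈ , y∈) , y≢x

distinct₃ : (p : Subset n) → 3 ≤ ∣ p ∣ → Distinct₃ p
distinct₃ p 3≤ with distinct₂ p (≤-trans (s≤s (s≤s z≤n)) 3≤)
... | x , y , (x∈ , y∈) , y≢x with fresh p (x ∷ y ∷ []) 3≤
... | z , z∈ , z≢x ∷ z≢y ∷ [] = x , y , z , (x∈ , y∈ , z∈) , y≢x , z≢x , z≢y

distinct₄ : (p : Subset n) → 4 ≤ ∣ p ∣ → Distinct₄ p
distinct₄ p 4≤ with distinct₃ p (≤-trans (s≤s (s≤s (s≤s z≤n))) 4≤)
... | x , y , z , (x∈ , y∈ , z∈) , y≢x , z≢x , z≢y with fresh p (x ∷ y ∷ z ∷ []) 4≤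
... | w , w∈ , w≢x ∷ w≢y ∷ w≢z ∷ [] =
  x , y , z , w , (x∈ , y∈ , z∈ , w∈) , y≢x , z≢x , z≢y , w≢x , w≢y , w≢z

-- Arithmetic of a minimal counterexample

2a≤b+2 : ∀ a b N → N + 4 ≤ b + 2 * a → 4 * a ≤ N + 6 → 2 * a ≤ b + 2
2a≤b+2 a b N small lines = linear 0 (+-mono-≤ small lines) (arith a b N)
  where
  arith : ∀ a b N → 2 * a + (b + 2 * a + (N + 6)) + 0 ≡ b + 2 + (N + 4 + 4 * a)
  arith = solve-∀

2a≤3h : ∀ a b N h → N + 4 ≤ b + 2 * a → 4 * a ≤ N + 6 → 3 * b ≤ N + 3 * h → 2 * a ≤ 3 * h
2a≤3h a b N h small lines translates =
  linear 0 (+-mono-≤ (+-mono-≤ bound bound) (+-mono-≤ small translates)) (arith a b N h)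
  where
  bound = 2a≤b+2 a b N small lines
  arith : ∀ a b N h → 2 * a + (b + 2 + (b + 2) + (b + 2 * a + (N + 3 * h))) + 0 ≡
    3 * h + (2 * a + 2 * a + (N + 4 + 3 * b))
  arith = solve-∀

-- The parameters of a minimal counterexample: a = |A|, b = |X|, N = |AX|, and h is the
-- order of the stabiliser of X, which has t cosets in X and u cosets in AX.  The hypotheses leave
-- only t = 2 and u = 3.
parameters : ∀ a b N h t u → 3 ≤ a → N + 4 ≤ b + 2 * a → 4 * a ≤ N + 6 →
  3 * b ≤ N + 3 * h → b + h ≤ N → b ≡ t * h → N ≡ u * h →
  b ≡ 2 * h × N ≡ 3 * h × h + 4 ≤ 2 * a × a ≤ h + 1
parameters a b N zero t u 3≤a small lines translates larger b≡ N≡ =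
  contradiction (≤-trans (*-monoʳ-≤ 2 3≤a) (2a≤3h a b N 0 small lines translates)) λ ()
parameters a b N h@(suc _) t u 3≤a small lines translates larger refl refl =
  by-cases t u 3t≤ u≤ t<u refl refl
  where
  bound = 2a≤b+2 a b N small lines
  h+4≤2a : h + 4 ≤ 2 * a
  h+4≤2a = linear 0 (+-mono-≤ small larger) (arith a b N h)
    where
    arith : ∀ a b N h → h + 4 + (b + 2 * a + N) + 0 ≡ 2 * a + (N + 4 + (b + h))
    arith = solve-∀
  3t≤ : 3 * t ≤ u + 3
  3t≤ = *-cancelʳ-≤ (3 * t) (u + 3) h (linear 0 translates (arith t u h))
    where
    arith : ∀ t u h → 3 * t * h + (u * h + 3 * h) + 0 ≡ (u + 3) * h + 3 * (t * h)
    arith = solve-∀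
  t<u : suc t ≤ u
  t<u = *-cancelʳ-≤ (suc t) u h (linear 0 larger (arith t u h))
    where
    arith : ∀ t u h → suc t * h + u * h + 0 ≡ u * h + (t * h + h)
    arith = solve-∀
  u≤ : u ≤ t + 2
  u≤ = ≤-pred (*-cancelʳ-< h u (suc (t + 2))
    (linear 3 (+-mono-≤ small (2a≤3h a b N h small lines translates)) (arith t u h a)))
    where
    arith : ∀ t u h a → suc (u * h) + (t * h + 2 * a + 3 * h) + 3 ≡ suc (t + 2) * h + (u * h + 4 + 2 * a)
    arith = solve-∀
  -- 3t ≤ u + 3 ≤ t + 5 gives t ≤ 2.  If t ≤ 1 or u = 4, the lower and the upper bound for a are
  -- incompatible.
  by-cases : ∀ t′ u′ → 3 * t′ ≤ u′ + 3 → u′ ≤ t′ + 2 → suc t′ ≤ u′ → t′ ≡ t → u′ ≡ u →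
    b ≡ 2 * h × N ≡ 3 * h × h + 4 ≤ 2 * a × a ≤ h + 1
  by-cases zero _ _ _ _ refl _ = ⊥-elim (infeasible 3 (+-mono-≤ 3≤a (+-mono-≤ 3≤a bound)) (arith a))
    where
    arith : ∀ a → suc (a + (a + 2) + 3) ≡ 3 + (3 + 2 * a)
    arith = solve-∀
  by-cases 1 _ _ _ _ refl _ = ⊥-elim (infeasible 1 (+-mono-≤ h+4≤2a bound) (arith h a))
    where
    arith : ∀ h a → suc (2 * a + (1 * h + 2) + 1) ≡ h + 4 + 2 * a
    arith = solve-∀
  by-cases 2 3 _ _ _ refl refl = refl , refl , h+4≤2a , *-cancelˡ-≤ 2 (linear 0 bound (arith a h))
    where
    arith : ∀ a h → 2 * a + (2 * h + 2) + 0 ≡ 2 * (h + 1) + 2 * a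
    arith = solve-∀
  by-cases 2 4 _ _ _ refl refl = ⊥-elim (infeasible 1 (+-mono-≤ small bound) (arith a h))
    where
    arith : ∀ a h → suc (2 * h + 2 * a + (2 * h + 2) + 1) ≡ 4 * h + 4 + 2 * a
    arith = solve-∀
  by-cases 2 0 _ _ () _ _
  by-cases 2 1 _ _ (s≤s ()) _ _
  by-cases 2 2 _ _ (s≤s (s≤s ())) _ _
  by-cases 2 (suc (suc (suc (suc (suc _))))) _ (s≤s (s≤s (s≤s (s≤s ())))) _ _ _
  by-cases (suc (suc (suc t′))) u′ 3t≤u u≤t _ _ _ = ⊥-elim
    (infeasible (2 * t′) (+-mono-≤ 3t≤u u≤t) (arith t′ u′))
    where
    arith : ∀ t u → suc (u + 3 + (3 + t + 2) + 2 * t) ≡ 3 * (3 + t) + u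
    arith = solve-∀

-- Translates and product sets

-- A group structure on Fin n, with propositional equality.
record FinGroup (n : ℕ) : Set where
  infixl 7 _·_
  infix  8 _⁻¹
  field
    _·_     : Fin n → Fin n → Fin n
    e       : Fin n
    _⁻¹     : Fin n → Fin n
    isGroup : IsGroup _≡_ _·_ e _⁻¹

  open IsGroup isGroup public using (assoc; identityˡ; identityʳ; inverseˡ; inverseʳ)

  asGroup : Group _ _
  asGroup = record { isGroup = isGroup }

  open GroupProperties asGroup public
    using (∙-cancelˡ; ∙-cancelʳ; \\-leftDividesˡ; \\-leftDividesʳ; //-rightDividesˡ; //-rightDividesʳ
          ; ⁻¹-involutive; ⁻¹-injective; ⁻¹-anti-homo-∙)

module _ {n : ℕ} (𝒢 : FinGroup n) where

  open FinGroup 𝒢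

  infixl 8 _⊙_
  infix  9 _◃_ _▹_
  infix  10 _⁻ˢ

  product? : (X Y : Subset n) (g : Fin n) → Dec (∃ λ x → ∃ λ y → x ∈ X × y ∈ Y × g ≡ x · y)
  product? X Y g = any? λ x → any? λ y → (x ∈? X) ×-dec (y ∈? Y) ×-dec (g ≟ (x · y))

  -- The product set XY.
  _⊙_ : Subset n → Subset n → Subset n
  X ⊙ Y = select (product? X Y)

  ⊙⁺ : (X Y : Subset n) {x y : Fin n} → x ∈ X → y ∈ Y → (x · y) ∈ (X ⊙ Y)
  ⊙⁺ X Y x∈X y∈Y = ∈-select⁺ (product? X Y) (_ , _ , x∈X , y∈Y , refl)

  ⊙⁻ : (X Y : Subset n) {g : Fin n} → g ∈ (X ⊙ Y) → ∃ λ x → ∃ λ y → x ∈ X × y ∈ Y × g ≡ x · y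
  ⊙⁻ X Y = ∈-select⁻ (product? X Y)

  ⊙-least : (X Y : Subset n) {Z : Subset n} → (∀ {x y} → x ∈ X → y ∈ Y → (x · y) ∈ Z) → X ⊙ Y ⊆ Z
  ⊙-least X Y {Z} closed g∈ with ⊙⁻ X Y g∈
  ... | _ , _ , x∈X , y∈Y , g≡xy = subst (_∈ Z) (sym g≡xy) (closed x∈X y∈Y)

  ⊙-monoˡ : {X X′ : Subset n} (Y : Subset n) → X ⊆ X′ → X ⊙ Y ⊆ X′ ⊙ Y
  ⊙-monoˡ {X} {X′} Y X⊆X′ = ⊙-least X Y (λ x∈ y∈ → ⊙⁺ X′ Y (X⊆X′ x∈) y∈)

  ⊙-monoʳ : (X : Subset n) {Y Y′ : Subset n} → Y ⊆ Y′ → X ⊙ Y ⊆ X ⊙ Y′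
  ⊙-monoʳ X {Y} {Y′} Y⊆Y′ = ⊙-least X Y (λ x∈ y∈ → ⊙⁺ X Y′ x∈ (Y⊆Y′ y∈))

  -- The translates g X and X g.
  _◃_ : Fin n → Subset n → Subset n
  g ◃ X = select λ i → (g ⁻¹ · i) ∈? X

  _▹_ : Subset n → Fin n → Subset n
  X ▹ g = select λ i → (i · g ⁻¹) ∈? X

  -- The set of inverses.
  _⁻ˢ : Subset n → Subset n
  X ⁻ˢ = select λ i → (i ⁻¹) ∈? X

  ◃⁺ : (g : Fin n) (X : Subset n) {x : Fin n} → x ∈ X → (g · x) ∈ (g ◃ X)
  ◃⁺ g X {x} x∈X = ∈-select⁺ (λ i → (g ⁻¹ · i) ∈? X) (subst (_∈ X) (sym (\\-leftDividesʳ g x)) x∈X)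

  ◃⁻ : (g : Fin n) (X : Subset n) {i : Fin n} → i ∈ (g ◃ X) → ∃ λ x → x ∈ X × i ≡ g · x
  ◃⁻ g X {i} i∈ = g ⁻¹ · i , ∈-select⁻ (λ i → (g ⁻¹ · i) ∈? X) i∈ , sym (\\-leftDividesˡ g i)

  ▹⁺ : (X : Subset n) (g : Fin n) {x : Fin n} → x ∈ X → (x · g) ∈ (X ▹ g)
  ▹⁺ X g {x} x∈X = ∈-select⁺ (λ i → (i · g ⁻¹) ∈? X) (subst (_∈ X) (sym (//-rightDividesʳ g x)) x∈X)

  ▹⁻ : (X : Subset n) (g : Fin n) {i : Fin n} → i ∈ (X ▹ g) → ∃ λ x → x ∈ X × i ≡ x · g
  ▹⁻ X g {i} i∈ = i · g ⁻¹ , ∈-select⁻ (λ i → (i · g ⁻¹) ∈? X) i∈ , sym (//-rightDividesˡ g i)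

  ⁻ˢ⁺ : (X : Subset n) {x : Fin n} → x ∈ X → (x ⁻¹) ∈ (X ⁻ˢ)
  ⁻ˢ⁺ X {x} x∈X = ∈-select⁺ (λ i → (i ⁻¹) ∈? X) (subst (_∈ X) (sym (⁻¹-involutive x)) x∈X)

  ⁻ˢ⁻ : (X : Subset n) {x : Fin n} → x ∈ (X ⁻ˢ) → (x ⁻¹) ∈ X
  ⁻ˢ⁻ X = ∈-select⁻ (λ i → (i ⁻¹) ∈? X)

  ◃-least : (g : Fin n) (X : Subset n) {Z : Subset n} → (∀ {x} → x ∈ X → (g · x) ∈ Z) → g ◃ X ⊆ Z
  ◃-least g X {Z} gX⊆Z i∈ with ◃⁻ g X i∈
  ... | _ , x∈X , i≡gx = subst (_∈ Z) (sym i≡gx) (gX⊆Z x∈X)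

  ▹-least : (X : Subset n) (g : Fin n) {Z : Subset n} → (∀ {x} → x ∈ X → (x · g) ∈ Z) → X ▹ g ⊆ Z
  ▹-least X g {Z} Xg⊆Z i∈ with ▹⁻ X g i∈
  ... | _ , x∈X , i≡xg = subst (_∈ Z) (sym i≡xg) (Xg⊆Z x∈X)

  ∣◃∣ : (g : Fin n) (X : Subset n) → ∣ g ◃ X ∣ ≡ ∣ X ∣
  ∣◃∣ g X = ≤-antisym
    (∣∣-injective-≤ (g ◃ X) X (g ⁻¹ ·_) (∈-select⁻ (λ i → (g ⁻¹ · i) ∈? X)) (∙-cancelˡ (g ⁻¹) _ _))
    (∣∣-injective-≤ X (g ◃ X) (g ·_) (◃⁺ g X) (∙-cancelˡ g _ _))

  ∣▹∣ : (X : Subset n) (g : Fin n) → ∣ X ▹ g ∣ ≡ ∣ X ∣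
  ∣▹∣ X g = ≤-antisym
    (∣∣-injective-≤ (X ▹ g) X (_· g ⁻¹) (∈-select⁻ (λ i → (i · g ⁻¹) ∈? X)) (∙-cancelʳ (g ⁻¹) _ _))
    (∣∣-injective-≤ X (X ▹ g) (_· g) (▹⁺ X g) (∙-cancelʳ g _ _))

  ∣⁻ˢ∣ : (X : Subset n) → ∣ X ⁻ˢ ∣ ≡ ∣ X ∣
  ∣⁻ˢ∣ X = ≤-antisym
    (∣∣-injective-≤ (X ⁻ˢ) X _⁻¹ (⁻ˢ⁻ X) ⁻¹-injective)
    (∣∣-injective-≤ X (X ⁻ˢ) _⁻¹ (⁻ˢ⁺ X) ⁻¹-injective)

  -- A set mapped into itself by a translation is also mapped into itself by
  -- the inverse translation.
  g·-closed⇒g⁻¹·-closed : {g : Fin n} (X : Subset n) → (∀ {x} → x ∈ X → (g · x) ∈ X) →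
                          ∀ {x} → x ∈ X → (g ⁻¹ · x) ∈ X
  g·-closed⇒g⁻¹·-closed {g} X closed x∈X = ∈-select⁻ (λ i → (g ⁻¹ · i) ∈? X)
    (⊆∧∣∣≥⇒⊇ (◃-least g X closed) (≤-reflexive (sym (∣◃∣ g X))) x∈X)

  ·g-closed⇒·g⁻¹-closed : {g : Fin n} (X : Subset n) → (∀ {x} → x ∈ X → (x · g) ∈ X) →
                          ∀ {x} → x ∈ X → (x · g ⁻¹) ∈ X
  ·g-closed⇒·g⁻¹-closed {g} X closed x∈X = ∈-select⁻ (λ i → (i · g ⁻¹) ∈? X)
    (⊆∧∣∣≥⇒⊇ (▹-least X g closed) (≤-reflexive (sym (∣▹∣ X g))) x∈X)

  ▹⊆⊙ : (X Y : Subset n) {y : Fin n} → y ∈ Y → X ▹ y ⊆ X ⊙ Y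
  ▹⊆⊙ X Y {y} y∈Y = ▹-least X y (λ x∈X → ⊙⁺ X Y x∈X y∈Y)

  ◃⊆⊙ : (X Y : Subset n) {x : Fin n} → x ∈ X → x ◃ Y ⊆ X ⊙ Y
  ◃⊆⊙ X Y {x} x∈X = ◃-least x Y (λ y∈Y → ⊙⁺ X Y x∈X y∈Y)

  ∣Y∣≤∣X⊙Y∣ : (X Y : Subset n) {x : Fin n} → x ∈ X → ∣ Y ∣ ≤ ∣ X ⊙ Y ∣
  ∣Y∣≤∣X⊙Y∣ X Y {x} x∈X = ≤-trans (≤-reflexive (sym (∣◃∣ x Y))) (p⊆q⇒∣p∣≤∣q∣ (◃⊆⊙ X Y x∈X))

  ∣X∣≤∣X⊙Y∣ : (X Y : Subset n) {y : Fin n} → y ∈ Y → ∣ X ∣ ≤ ∣ X ⊙ Y ∣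
  ∣X∣≤∣X⊙Y∣ X Y {y} y∈Y = ≤-trans (≤-reflexive (sym (∣▹∣ X y))) (p⊆q⇒∣p∣≤∣q∣ (▹⊆⊙ X Y y∈Y))

  -- A (X ∪ Y) = AX ∪ AY and A (X ∩ Y) ⊆ AX ∩ AY, and similarly on the other side.
  submodularʳ : (A X Y : Subset n) →
    ∣ A ⊙ (X ∪ Y) ∣ + ∣ A ⊙ (X ∩ Y) ∣ ≤ ∣ A ⊙ X ∣ + ∣ A ⊙ Y ∣
  submodularʳ A X Y = ≤-trans
    (+-mono-≤
      (p⊆q⇒∣p∣≤∣q∣ {q = A ⊙ X ∪ A ⊙ Y} (⊙-least A (X ∪ Y) (λ a∈ z∈ → case x∈p∪q⁻ X Y z∈ of λ where
        (inj₁ z∈X) → x∈p∪q⁺ (inj₁ (⊙⁺ A X a∈ z∈X))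
        (inj₂ z∈Y) → x∈p∪q⁺ (inj₂ (⊙⁺ A Y a∈ z∈Y)))))
      (p⊆q⇒∣p∣≤∣q∣ {q = A ⊙ X ∩ A ⊙ Y} (λ z∈ → x∈p∩q⁺
        (⊙-monoʳ A (p∩q⊆p X Y) z∈ , ⊙-monoʳ A (p∩q⊆q X Y) z∈))))
    (≤-reflexive (∣∪∣+∣∩∣ (A ⊙ X) (A ⊙ Y)))

  submodularˡ : (X Y S : Subset n) →
    ∣ (X ∪ Y) ⊙ S ∣ + ∣ (X ∩ Y) ⊙ S ∣ ≤ ∣ X ⊙ S ∣ + ∣ Y ⊙ S ∣
  submodularˡ X Y S = ≤-trans
    (+-mono-≤
      (p⊆q⇒∣p∣≤∣q∣ {q = X ⊙ S ∪ Y ⊙ S} (⊙-least (X ∪ Y) S (λ z∈ s∈ → case x∈p∪q⁻ X Y z∈ of λ where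
        (inj₁ z∈X) → x∈p∪q⁺ (inj₁ (⊙⁺ X S z∈X s∈))
        (inj₂ z∈Y) → x∈p∪q⁺ (inj₂ (⊙⁺ Y S z∈Y s∈)))))
      (p⊆q⇒∣p∣≤∣q∣ {q = X ⊙ S ∩ Y ⊙ S} (λ z∈ → x∈p∩q⁺
        (⊙-monoˡ S (p∩q⊆p X Y) z∈ , ⊙-monoˡ S (p∩q⊆q X Y) z∈))))
    (≤-reflexive (∣∪∣+∣∩∣ (X ⊙ S) (Y ⊙ S)))

  ∣X⊙Y▹g∣ : (X Y : Subset n) (g : Fin n) → ∣ X ⊙ (Y ▹ g) ∣ ≤ ∣ X ⊙ Y ∣
  ∣X⊙Y▹g∣ X Y g = ≤-trans (p⊆q⇒∣p∣≤∣q∣ {q = (X ⊙ Y) ▹ g} (⊙-least X (Y ▹ g) shift))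
    (≤-reflexive (∣▹∣ (X ⊙ Y) g))
    where
    shift : ∀ {x z} → x ∈ X → z ∈ (Y ▹ g) → (x · z) ∈ ((X ⊙ Y) ▹ g)
    shift {x} x∈X z∈ with ▹⁻ Y g z∈
    ... | y , y∈Y , refl = subst (_∈ ((X ⊙ Y) ▹ g)) (assoc x y g) (▹⁺ (X ⊙ Y) g (⊙⁺ X Y x∈X y∈Y))

  ∣g◃X⊙Y∣ : (g : Fin n) (X Y : Subset n) → ∣ (g ◃ X) ⊙ Y ∣ ≤ ∣ X ⊙ Y ∣
  ∣g◃X⊙Y∣ g X Y = ≤-trans (p⊆q⇒∣p∣≤∣q∣ {q = g ◃ (X ⊙ Y)} (⊙-least (g ◃ X) Y shift))
    (≤-reflexive (∣◃∣ g (X ⊙ Y)))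
    where
    shift : ∀ {z y} → z ∈ (g ◃ X) → y ∈ Y → (z · y) ∈ (g ◃ (X ⊙ Y))
    shift {y = y} z∈ y∈Y with ◃⁻ g X z∈
    ... | x , x∈X , refl = subst (_∈ (g ◃ (X ⊙ Y))) (sym (assoc g x y)) (◃⁺ g (X ⊙ Y) (⊙⁺ X Y x∈X y∈Y))

-- Sidon sets

  -- A is a Sidon set when distinct left translates of A meet in at most one element.
  -- Equivalently, an element g ≠ 1 is a quotient v u⁻¹ of elements of A in at most one way.
  Sidon : Subset n → Set
  Sidon A = ∀ {g u v} → g ≢ e → u ∈ A → v ∈ A → (g · u) ∈ A → (g · v) ∈ A → u ≡ v

  xy⁻¹≢e : {x y : Fin n} → x ≢ y → x · y ⁻¹ ≢ e
  xy⁻¹≢e {x} {y} x≢y eq = x≢y (trans (sym (//-rightDividesˡ y x)) (trans (cong (_· y) eq) (identityˡ y)))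

  x≢xz : {x z : Fin n} → z ≢ e → x ≢ x · z
  x≢xz {x} {z} z≢e eq = z≢e (∙-cancelˡ x z e (trans (sym eq) (sym (identityʳ x))))

  -- The same for the quotients u⁻¹ v.  If uk and vk lie in A, then v u⁻¹ translates both u to v
  -- and uk to vk.
  sidonʳ : {A : Subset n} → Sidon A → ∀ {k u v} → k ≢ e →
           u ∈ A → v ∈ A → (u · k) ∈ A → (v · k) ∈ A → u ≡ v
  sidonʳ {A} sidon {k} {u} {v} k≢e u∈ v∈ uk∈ vk∈ with u ≟ v
  ... | yes u≡v = u≡v
  ... | no  u≢v = contradiction
    (sidon {g = v · u ⁻¹} (xy⁻¹≢e (u≢v ∘ sym)) u∈ uk∈
      (subst (_∈ A) (sym (//-rightDividesˡ u v)) v∈)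
      (subst (_∈ A) (trans (cong (_· k) (sym (//-rightDividesˡ u v))) (assoc _ u k)) vk∈))
    (x≢xz k≢e)

  sidon-⁻ˢ : {A : Subset n} → Sidon A → Sidon (A ⁻ˢ)
  sidon-⁻ˢ {A} sidon {g} {u} {v} g≢e u∈ v∈ gu∈ gv∈ = ⁻¹-injective
    (sidonʳ sidon {k = g ⁻¹} (λ g⁻¹≡e → g≢e (trans (sym (identityʳ g)) (trans (cong (g ·_) (sym g⁻¹≡e)) (inverseʳ g))))
      (⁻ˢ⁻ A u∈) (⁻ˢ⁻ A v∈)
      (subst (_∈ A) (⁻¹-anti-homo-∙ g u) (⁻ˢ⁻ A gu∈))
      (subst (_∈ A) (⁻¹-anti-homo-∙ g v) (⁻ˢ⁻ A gv∈)))

  -- Distinct right translates Ax and Ay of a Sidon set have at most one common element.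
  common-unique : {A : Subset n} → Sidon A → ∀ {x y a b c d} → x ≢ y →
    a ∈ A → b ∈ A → c ∈ A → d ∈ A → a · x ≡ b · y → c · x ≡ d · y → a ≡ c
  common-unique {A} sidon {x} {y} x≢y a∈ b∈ c∈ d∈ ax≡by cx≡dy =
    sidonʳ sidon (xy⁻¹≢e x≢y) a∈ c∈ (into ax≡by b∈) (into cx≡dy d∈)
    where
    into : ∀ {a b} → a · x ≡ b · y → b ∈ A → (a · (x · y ⁻¹)) ∈ A
    into {a} {b} eq = subst (_∈ A) (sym (trans (sym (assoc a x (y ⁻¹)))
      (trans (cong (_· y ⁻¹) eq) (//-rightDividesʳ y b))))

  ∣Ax∩Ay∣≤1 : {A : Subset n} → Sidon A → ∀ {x y} → x ≢ y → ∣ (A ▹ x) ∩ (A ▹ y) ∣ ≤ 1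
  ∣Ax∩Ay∣≤1 {A} sidon {x} {y} x≢y = ∣∣≤1 ((A ▹ x) ∩ (A ▹ y)) unique
    where
    unique : ∀ {p q} → p ∈ ((A ▹ x) ∩ (A ▹ y)) → q ∈ ((A ▹ x) ∩ (A ▹ y)) → p ≡ q
    unique p∈ q∈ with x∈p∩q⁻ (A ▹ x) (A ▹ y) p∈ | x∈p∩q⁻ (A ▹ x) (A ▹ y) q∈
    ... | p∈x , p∈y | q∈x , q∈y with ▹⁻ A x p∈x | ▹⁻ A y p∈y | ▹⁻ A x q∈x | ▹⁻ A y q∈y
    ... | a , a∈ , p≡ax | b , b∈ , p≡by | c , c∈ , q≡cx | d , d∈ , q≡dy =
      trans p≡ax (trans (cong (_· x)
        (common-unique sidon x≢y a∈ b∈ c∈ d∈ (trans (sym p≡ax) p≡by) (trans (sym q≡cx) q≡dy)))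
        (sym q≡cx))

-- Subgroups generated by a Sidon set

  -- A is a Sidon set containing 1, and W is the subgroup generated by A.  The generation is
  -- expressed by the field least: a nonempty subset Y of W with AY ⊆ Y is all of W.
  record Generating (W A : Subset n) : Set where
    field
      sidon     : Sidon A
      e∈A       : e ∈ A
      A⊆W       : A ⊆ W
      ·-closed  : ∀ {x y} → x ∈ W → y ∈ W → (x · y) ∈ W
      ⁻¹-closed : ∀ {x} → x ∈ W → (x ⁻¹) ∈ W
      least     : ∀ (Y : Subset n) {y} → y ∈ Y → Y ⊆ W →
                  (∀ {a y} → a ∈ A → y ∈ Y → (a · y) ∈ Y) → W ⊆ Y

    e∈W : e ∈ W
    e∈W = A⊆W e∈A

    A⊙X⊆W : (X : Subset n) → X ⊆ W → A ⊙ X ⊆ W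
    A⊙X⊆W X X⊆W = ⊙-least A X (λ a∈ x∈ → ·-closed (A⊆W a∈) (X⊆W x∈))

  generating-⁻ˢ : {W A : Subset n} → Generating W A → Generating W (A ⁻ˢ)
  generating-⁻ˢ {W} {A} gen = record
    { sidon     = sidon-⁻ˢ sidon
    ; e∈A       = subst (_∈ (A ⁻ˢ)) (trans (sym (identityˡ (e ⁻¹))) (inverseʳ e)) (⁻ˢ⁺ A e∈A)
    ; A⊆W       = λ {x} x∈ → subst (_∈ W) (⁻¹-involutive x) (⁻¹-closed (A⊆W (⁻ˢ⁻ A x∈)))
    ; ·-closed  = ·-closed
    ; ⁻¹-closed = ⁻¹-closed
    ; least     = λ Y y∈Y Y⊆W closed → least Y y∈Y Y⊆W (λ {a} {y} a∈ y∈ →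
        subst (λ b → (b · y) ∈ Y) (⁻¹-involutive a)
          (g·-closed⇒g⁻¹·-closed Y (closed (⁻ˢ⁺ A a∈)) y∈))
    }
    where open Generating gen

  -- The sets X ⊆ W with |X| ≥ 2 and at least two elements of W outside AX.
  record Admissible (W A X : Subset n) : Set where
    field
      2≤∣X∣   : 2 ≤ ∣ X ∣
      X⊆W     : X ⊆ W
      room    : ∣ A ⊙ X ∣ + 2 ≤ ∣ W ∣

  -- The inequality |AX| - |X| ≥ 2|A| - 3.
  Large : Subset n → Subset n → Set
  Large A X = ∣ X ∣ + 2 * ∣ A ∣ ≤ ∣ A ⊙ X ∣ + 3

  -- An admissible X that is not large, with the least excess |AX| - |X| for the set A, and with the
  -- least size among the admissible sets of no larger excess, for all Sidon sets A′
  -- of the size of A that contain 1 and generate W.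
  record Counterexample (W A X : Subset n) : Set where
    field
      generating : Generating W A
      3≤∣A∣      : 3 ≤ ∣ A ∣
      admissible : Admissible W A X
      small      : ∣ A ⊙ X ∣ + 4 ≤ ∣ X ∣ + 2 * ∣ A ∣
      least-excess : ∀ (X′ : Subset n) → Admissible W A X′ →
        ∣ A ⊙ X ∣ + ∣ X′ ∣ ≤ ∣ A ⊙ X′ ∣ + ∣ X ∣
      least-size : ∀ (A′ X′ : Subset n) → Generating W A′ → ∣ A′ ∣ ≡ ∣ A ∣ → Admissible W A′ X′ →
        ∣ A′ ⊙ X′ ∣ + ∣ X ∣ ≤ ∣ A ⊙ X ∣ + ∣ X′ ∣ → ∣ X ∣ ≤ ∣ X′ ∣
    open Generating generating public
    open Admissible admissible public

  module _ {W A X : Subset n} (cex : Counterexample W A X) where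

    open Counterexample cex

    private
      N = ∣ A ⊙ X ∣

      ∣Ax∣ : ∀ x → ∣ A ▹ x ∣ ≡ ∣ A ∣
      ∣Ax∣ = ∣▹∣ A

      Ax⊆ : ∀ {x} → x ∈ X → A ▹ x ⊆ A ⊙ X
      Ax⊆ = ▹⊆⊙ A X

    -- Duality: the set X* = W ∖ AX satisfies A⁻¹ X* ⊆ W ∖ X, so the excess of X* with respect to
    -- A⁻¹ is at most that of X, and |X| ≤ |X*|.
    room-X : ∣ X ∣ + N ≤ ∣ W ∣
    room-X = ≤-trans (+-monoˡ-≤ N
        (least-size (A ⁻ˢ) X* (generating-⁻ˢ generating) (∣⁻ˢ∣ A)
          (record { 2≤∣X∣ = 2≤∣X*∣ ; X⊆W = p─q⊆p W (A ⊙ X) ; room = room* })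
          (≤-trans disjoint (≤-reflexive (sym ∣X*∣)))))
      (≤-reflexive (trans (+-comm (∣ X* ∣) N) ∣X*∣))
      where
      X* : Subset n
      X* = W ─ (A ⊙ X)
      ∣X*∣ : N + ∣ X* ∣ ≡ ∣ W ∣
      ∣X*∣ = ∣─∣ W (A ⊙ X) (A⊙X⊆W X X⊆W)
      2≤∣X*∣ : 2 ≤ ∣ X* ∣
      2≤∣X*∣ = +-cancelˡ-≤ N 2 (∣ X* ∣) (≤-trans room (≤-reflexive (sym ∣X*∣)))
      disjoint : ∣ A ⁻ˢ ⊙ X* ∣ + ∣ X ∣ ≤ ∣ W ∣
      disjoint = disjoint-≤ (A ⁻ˢ ⊙ X*) X W
        (Generating.A⊙X⊆W (generating-⁻ˢ generating) X* (p─q⊆p W (A ⊙ X))) X⊆W avoid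
        where
        avoid : ∀ {x} → x ∈ (A ⁻ˢ ⊙ X*) → x ∉ X
        avoid x∈ x∈X with ⊙⁻ (A ⁻ˢ) X* x∈
        ... | b , p , b∈ , p∈ , refl = x∈p─q⇒x∉q W (A ⊙ X) p∈
          (subst (_∈ (A ⊙ X)) (\\-leftDividesʳ b p) (⊙⁺ A X (⁻ˢ⁻ A b∈) x∈X))
      room* : ∣ A ⁻ˢ ⊙ X* ∣ + 2 ≤ ∣ W ∣
      room* = ≤-trans (+-monoʳ-≤ _ 2≤∣X∣) disjoint

    Ax∩Ay : ∀ {x y} → y ≢ x → ∣ (A ▹ x) ∩ (A ▹ y) ∣ ≤ 1
    Ax∩Ay y≢x = ∣Ax∩Ay∣≤1 sidon (y≢x ∘ sym)

    -- The translates Ax with x ∈ X are regarded as lines in AX, two of which meet in at most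
    -- one point.
    2-lines : 2 * ∣ A ∣ ≤ N + 1
    2-lines with x , y , (x∈ , y∈) , y≢x ← distinct₂ X 2≤∣X∣ =
      times₂ (∣ A ∣) (∣Ax∣ x) (∣Ax∣ y)
        (≤-trans (inclusion-exclusion₂ (A ▹ x) (A ▹ y) (A ⊙ X) (Ax⊆ x∈) (Ax⊆ y∈))
          (+-monoʳ-≤ N (Ax∩Ay y≢x)))

    3≤∣X∣ : 3 ≤ ∣ X ∣
    3≤∣X∣ = linear 0 (+-mono-≤ small 2-lines) (arith (∣ A ∣) (∣ X ∣) N)
      where
      arith : ∀ a b N → 3 + (b + 2 * a + (N + 1)) + 0 ≡ b + (N + 4 + 2 * a)
      arith = solve-∀

    3-lines : 3 * ∣ A ∣ ≤ N + 3
    3-lines = lines (distinct₃ X 3≤∣X∣)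
      where
      lines : Distinct₃ X → 3 * ∣ A ∣ ≤ N + 3
      lines (x , y , z , (x∈ , y∈ , z∈) , y≢x , z≢x , z≢y) =
        times₃ (∣ A ∣) (∣Ax∣ x) (∣Ax∣ y) (∣Ax∣ z)
          (inclusion-exclusion₃ (A ▹ x) (A ▹ y) (A ▹ z) (A ⊙ X)
          (Ax⊆ x∈) (Ax⊆ y∈) (Ax⊆ z∈) (Ax∩Ay y≢x) (Ax∩Ay z≢x) (Ax∩Ay z≢y))

    ∣A∣<∣X∣ : ∣ A ∣ < ∣ X ∣
    ∣A∣<∣X∣ = linear 0 (+-mono-≤ small 3-lines) (arith (∣ A ∣) (∣ X ∣) N)
      where
      arith : ∀ a b N → suc a + (b + 2 * a + (N + 3)) + 0 ≡ b + (N + 4 + 3 * a)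
      arith = solve-∀

    4-lines : 4 * ∣ A ∣ ≤ N + 6
    4-lines = lines (distinct₄ X (≤-trans (s≤s 3≤∣A∣) ∣A∣<∣X∣))
      where
      lines : Distinct₄ X → 4 * ∣ A ∣ ≤ N + 6
      lines (x , y , z , w , (x∈ , y∈ , z∈ , w∈) , y≢x , z≢x , z≢y , w≢x , w≢y , w≢z) =
        times₄ (∣ A ∣) (∣Ax∣ x) (∣Ax∣ y) (∣Ax∣ z) (∣Ax∣ w)
          (inclusion-exclusion₄ (A ▹ x) (A ▹ y) (A ▹ z) (A ▹ w) (A ⊙ X) 1
          (Ax⊆ x∈) (Ax⊆ y∈) (Ax⊆ z∈) (Ax⊆ w∈)
          (Ax∩Ay y≢x) (Ax∩Ay z≢x) (Ax∩Ay z≢y) (Ax∩Ay w≢x) (Ax∩Ay w≢y) (Ax∩Ay w≢z))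

    -- The intersection property.  If X ∩ Xg is smaller than X, then it has a larger excess than X
    -- by minimality, so that X ∪ Xg has a smaller one by submodularity, a contradiction.  The union is admissible
    -- because |W| ≥ |X| + |AX|.
    two-common⇒periodic : ∀ {g u v} → u ≢ v → u ∈ X → v ∈ X → (u · g) ∈ X → (v · g) ∈ X →
                          ∀ {x} → x ∈ X → (x · g) ∈ X
    two-common⇒periodic {g} {u} {v} u≢v u∈ v∈ ug∈ vg∈ with ∣ X ∣ ≤? ∣ X ∩ (X ▹ g) ∣
    ... | yes b≤∣I∣ = λ x∈ → Y⊆X (▹⁺ X g x∈)
      where
      X⊆Y : X ⊆ X ▹ g
      X⊆Y x∈ = p∩q⊆q X (X ▹ g) (⊆∧∣∣≥⇒⊇ (p∩q⊆p X (X ▹ g)) b≤∣I∣ x∈)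
      Y⊆X : X ▹ g ⊆ X
      Y⊆X = ⊆∧∣∣≥⇒⊇ X⊆Y (≤-reflexive (∣▹∣ X g))
    ... | no b≰∣I∣ = contradiction (least-excess U admissible-U) (<⇒≱ U-smaller)
      where
      Y = X ▹ g
      I = X ∩ Y
      U = X ∪ Y

      g∈W : g ∈ W
      g∈W = subst (_∈ W) (\\-leftDividesʳ u g) (·-closed (⁻¹-closed (X⊆W u∈)) (X⊆W ug∈))

      Y⊆W : Y ⊆ W
      Y⊆W = ▹-least X g (λ x∈ → ·-closed (X⊆W x∈) g∈W)

      2≤∣I∣ : 2 ≤ ∣ I ∣
      2≤∣I∣ = 2≤∣∣ (x∈p∩q⁺ (ug∈ , ▹⁺ X g u∈)) (x∈p∩q⁺ (vg∈ , ▹⁺ X g v∈)) (u≢v ∘ ∙-cancelʳ g u v)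

      admissible-I : Admissible W A I
      admissible-I = record
        { 2≤∣X∣ = 2≤∣I∣
        ; X⊆W   = λ z∈ → X⊆W (p∩q⊆p X Y z∈)
        ; room  = ≤-trans (+-monoˡ-≤ 2 (p⊆q⇒∣p∣≤∣q∣ (⊙-monoʳ A (p∩q⊆p X Y)))) room
        }

      I-larger : N + ∣ I ∣ < ∣ A ⊙ I ∣ + ∣ X ∣
      I-larger = ≰⇒> (λ le → b≰∣I∣ (least-size A I generating refl admissible-I le))

      ∣AU∣+∣AI∣ : ∣ A ⊙ U ∣ + ∣ A ⊙ I ∣ ≤ N + N
      ∣AU∣+∣AI∣ = ≤-trans (submodularʳ A X Y) (+-monoʳ-≤ N (∣X⊙Y▹g∣ A X g))

      ∣U∣+∣I∣ : ∣ U ∣ + ∣ I ∣ ≡ ∣ X ∣ + ∣ X ∣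
      ∣U∣+∣I∣ = trans (∣∪∣+∣∩∣ X Y) (cong (_+_ (∣ X ∣)) (∣▹∣ X g))

      admissible-U : Admissible W A U
      admissible-U = record
        { 2≤∣X∣ = ≤-trans 2≤∣X∣ (∣p∣≤∣p∪q∣ X Y)
        ; X⊆W   = ∪-least X⊆W Y⊆W
        ; room  = linear 1 (+-mono-≤ ∣AU∣+∣AI∣ (+-mono-≤ I-larger (+-mono-≤ 2≤∣I∣ room-X)))
            (arith (∣ A ⊙ U ∣) (∣ A ⊙ I ∣) N (∣ I ∣) (∣ X ∣) (∣ W ∣))
        }
        where
        arith : ∀ AU AI N I b w → AU + 2 + (N + N + (AI + b + (I + w))) + 1 ≡
          w + (AU + AI + (suc (N + I) + (2 + (b + N))))
        arith = solve-∀

      U-smaller : ∣ A ⊙ U ∣ + ∣ X ∣ < N + ∣ U ∣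
      U-smaller = linear 0 (+-mono-≤ ∣AU∣+∣AI∣ (+-mono-≤ I-larger (≤-reflexive (sym ∣U∣+∣I∣))))
        (arith (∣ A ⊙ U ∣) (∣ A ⊙ I ∣) N (∣ I ∣) (∣ X ∣) (∣ U ∣))
        where
        arith : ∀ AU AI N I b U → suc (AU + b) + (N + N + (AI + b + (U + I))) + 0 ≡
          N + U + (AU + AI + (suc (N + I) + (b + b)))
        arith = solve-∀

-- The right stabiliser of a counterexample

    private
      H? : ∀ g → Dec (X ▹ g ⊆ X)
      H? g = (X ▹ g) ⊆? X

    -- The stabiliser H = { g : Xg = X }; by finiteness Xg ⊆ X suffices.
    H : Subset n
    H = select H?

    H⁻ : ∀ {h} → h ∈ H → ∀ {x} → x ∈ X → (x · h) ∈ X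
    H⁻ {h} h∈ x∈ = ∈-select⁻ H? h∈ (▹⁺ X h x∈)

    H⁺ : ∀ {h} → (∀ {x} → x ∈ X → (x · h) ∈ X) → h ∈ H
    H⁺ {h} closed = ∈-select⁺ H? (λ {i} → ▹-least X h closed {i})

    e∈H : e ∈ H
    e∈H = H⁺ (λ {x} x∈ → subst (_∈ X) (sym (identityʳ x)) x∈)

    H-⁻¹ : ∀ {h} → h ∈ H → (h ⁻¹) ∈ H
    H-⁻¹ h∈ = H⁺ (·g-closed⇒·g⁻¹-closed X (H⁻ h∈))

    H-· : ∀ {h k} → h ∈ H → k ∈ H → (h · k) ∈ H
    H-· {h} {k} h∈ k∈ = H⁺ (λ {x} x∈ → subst (_∈ X) (assoc x h k) (H⁻ k∈ (H⁻ h∈ x∈)))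

    -- Y is a union of left cosets of H.
    Periodic : Subset n → Set
    Periodic Y = ∀ {y h} → y ∈ Y → h ∈ H → (y · h) ∈ Y

    A⊙X-periodic : Periodic (A ⊙ X)
    A⊙X-periodic {h = h} y∈ h∈ with a , x , a∈ , x∈ , refl ← ⊙⁻ A X y∈ =
      subst (_∈ (A ⊙ X)) (sym (assoc a x h)) (⊙⁺ A X a∈ (H⁻ h∈ x∈))

    ◃H⊆ : ∀ {Y} → Periodic Y → ∀ {y} → y ∈ Y → y ◃ H ⊆ Y
    ◃H⊆ periodic {y} y∈ = ◃-least y H (periodic y∈)

    ─-periodic : ∀ {Y Z} → Periodic Y → Periodic Z → Periodic (Y ─ Z)
    ─-periodic {Y} {Z} pY pZ {y} {h} y∈ h∈ with y∈Y , y∉Z ← p─q⁻ Y Z y∈ =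
      x∈p∧x∉q⇒x∈p─q (pY y∈Y h∈) (λ yh∈Z → y∉Z
        (subst (_∈ Z) (//-rightDividesʳ h y) (pZ yh∈Z (H-⁻¹ h∈))))

    coset-periodic : ∀ y → Periodic (y ◃ H)
    coset-periodic y {h = h} z∈ h∈ with k , k∈ , refl ← ◃⁻ y H z∈ =
      subst (_∈ (y ◃ H)) (sym (assoc y k h)) (◃⁺ y H (H-· k∈ h∈))

    ∣H∣-divides : ∀ Y → Periodic Y → ∃ λ t → ∣ Y ∣ ≡ t * ∣ H ∣
    ∣H∣-divides Y pY = go (∣ Y ∣) Y ≤-refl pY
      where
      go : ∀ m Y → ∣ Y ∣ ≤ m → Periodic Y → ∃ λ t → ∣ Y ∣ ≡ t * ∣ H ∣
      go m Y Y≤m pY with nonempty? Y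
      ... | no empty = 0 , ∣∣≡0 Y (λ {x} x∈ → empty (x , x∈))
      go zero    Y Y≤m pY | yes (y , y∈) = contradiction (≤-trans (1≤∣∣ y∈) Y≤m) λ ()
      go (suc m) Y Y≤m pY | yes (y , y∈) = step (go m Y′ (≤-pred (≤-trans Y′<Y Y≤m)) (─-periodic pY (coset-periodic y)))
        where
        Y′ = Y ─ (y ◃ H)
        size : ∣ y ◃ H ∣ + ∣ Y′ ∣ ≡ ∣ Y ∣
        size = ∣─∣ Y (y ◃ H) (◃H⊆ pY y∈)
        Y′<Y : ∣ Y′ ∣ < ∣ Y ∣
        Y′<Y = ≤-trans (+-monoˡ-≤ (∣ Y′ ∣) (≤-trans (1≤∣∣ e∈H) (≤-reflexive (sym (∣◃∣ y H))))) (≤-reflexive size)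
        step : (∃ λ t → ∣ Y′ ∣ ≡ t * ∣ H ∣) → ∃ λ t → ∣ Y ∣ ≡ t * ∣ H ∣
        step (t , eq) = suc t , trans (sym size) (cong₂ _+_ (∣◃∣ y H) eq)

    xX⊆ : ∀ {a} → a ∈ A → a ◃ X ⊆ A ⊙ X
    xX⊆ = ◃⊆⊙ A X

    -- A common point p = xu = yv and another one q = xu′ = yv′ have p⁻¹q = u⁻¹u′ = v⁻¹v′, which
    -- translates the distinct points u, v of X into X, hence belongs to H.
    ∣xX∩yX∣≤∣H∣ : ∀ {x y} → y ≢ x → ∣ (x ◃ X) ∩ (y ◃ X) ∣ ≤ ∣ H ∣
    ∣xX∩yX∣≤∣H∣ {x} {y} y≢x with nonempty? ((x ◃ X) ∩ (y ◃ X))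
    ... | no empty = ≤-trans (≤-reflexive (∣∣≡0 ((x ◃ X) ∩ (y ◃ X)) (λ {p} p∈ → empty (p , p∈)))) z≤n
    ... | yes (p , p∈) = ≤-trans (p⊆q⇒∣p∣≤∣q∣ {q = p ◃ H} in-coset) (≤-reflexive (∣◃∣ p H))
      where
      quotient∈H : ∀ {q u v u′ v′} → u ∈ X → v ∈ X → u′ ∈ X → v′ ∈ X →
        p ≡ x · u → p ≡ y · v → q ≡ x · u′ → q ≡ y · v′ → (p ⁻¹ · q) ∈ H
      quotient∈H {q} {u} {v} {u′} {v′} u∈ v∈ u′∈ v′∈ p≡xu p≡yv q≡xu′ q≡yv′ =
        H⁺ (two-common⇒periodic u≢v u∈ v∈ (subst (_∈ X) (sym (shift p≡xu q≡xu′)) u′∈)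
                                   (subst (_∈ X) (sym (shift p≡yv q≡yv′)) v′∈))
        where
        shift : ∀ {z w w′} → p ≡ z · w → q ≡ z · w′ → w · (p ⁻¹ · q) ≡ w′
        shift {z} {w} {w′} p≡zw q≡zw′ = ∙-cancelˡ z _ _ (begin
          z · (w · (p ⁻¹ · q)) ≡⟨ sym (assoc z w _) ⟩
          z · w · (p ⁻¹ · q)   ≡⟨ cong (_· (p ⁻¹ · q)) (sym p≡zw) ⟩
          p · (p ⁻¹ · q)       ≡⟨ \\-leftDividesˡ p q ⟩
          q                    ≡⟨ q≡zw′ ⟩
          z · w′               ∎)
          where open ≡-Reasoning
        u≢v : u ≢ v
        u≢v refl = y≢x (∙-cancelʳ u y x (trans (sym p≡yv) p≡xu))

      in-coset : (x ◃ X) ∩ (y ◃ X) ⊆ p ◃ H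
      in-coset {q} q∈ with x∈p∩q⁻ (x ◃ X) (y ◃ X) p∈ | x∈p∩q⁻ (x ◃ X) (y ◃ X) q∈
      ... | p∈x , p∈y | q∈x , q∈y
        with u , u∈ , p≡xu ← ◃⁻ x X p∈x | v , v∈ , p≡yv ← ◃⁻ y X p∈y
           | u′ , u′∈ , q≡xu′ ← ◃⁻ x X q∈x | v′ , v′∈ , q≡yv′ ← ◃⁻ y X q∈y =
        subst (_∈ (p ◃ H)) (\\-leftDividesˡ p q)
          (◃⁺ p H (quotient∈H u∈ v∈ u′∈ v′∈ p≡xu p≡yv q≡xu′ q≡yv′))

    3-translates : 3 * ∣ X ∣ ≤ N + 3 * ∣ H ∣
    3-translates = translates (distinct₃ A 3≤∣A∣)
      where
      translates : Distinct₃ A → 3 * ∣ X ∣ ≤ N + 3 * ∣ H ∣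
      translates (x , y , z , (x∈ , y∈ , z∈) , y≢x , z≢x , z≢y) =
        ≤-trans
          (times₃ (∣ X ∣) (∣◃∣ x X) (∣◃∣ y X) (∣◃∣ z X)
            (inclusion-exclusion₃ (x ◃ X) (y ◃ X) (z ◃ X) (A ⊙ X) (xX⊆ x∈) (xX⊆ y∈) (xX⊆ z∈)
              (∣xX∩yX∣≤∣H∣ y≢x) (∣xX∩yX∣≤∣H∣ z≢x) (∣xX∩yX∣≤∣H∣ z≢y)))
          (≤-reflexive (cong (_+_ N) (sym (arith (∣ H ∣)))))
        where
        arith : ∀ h → 3 * h ≡ h + h + h
        arith = solve-∀

    -- AX properly contains X, since otherwise X = W; hence it contains a further coset of H.
    ∣X∣+∣H∣≤ : ∣ X ∣ + ∣ H ∣ ≤ N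
    ∣X∣+∣H∣≤ with ⊆-or-∃ (A ⊙ X) X
    ... | inj₁ AX⊆X with nonempty? X
    ...   | no empty = contradiction (≤-trans 2≤∣X∣ (≤-reflexive (∣∣≡0 X (λ {x} x∈ → empty (x , x∈))))) λ ()
    ...   | yes (x , x∈) = contradiction
      (+-cancelˡ-≤ (∣ X ∣) 2 0 (≤-trans (+-monoˡ-≤ 2 (∣Y∣≤∣X⊙Y∣ A X e∈A))
        (≤-trans room (≤-trans (p⊆q⇒∣p∣≤∣q∣ W⊆X) (≤-reflexive (sym (+-identityʳ _)))))))
      λ ()
      where
      W⊆X : W ⊆ X
      W⊆X = least X x∈ X⊆W (λ a∈ y∈ → AX⊆X (⊙⁺ A X a∈ y∈))
    ∣X∣+∣H∣≤ | inj₂ (p , p∈ , p∉) = ≤-trans (≤-reflexive (cong (_+_ (∣ X ∣)) (sym (∣◃∣ p H))))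
      (disjoint-≤ X (p ◃ H) (A ⊙ X) X⊆AX (◃H⊆ A⊙X-periodic p∈) avoid)
      where
      X⊆AX : X ⊆ A ⊙ X
      X⊆AX {x} x∈ = subst (_∈ (A ⊙ X)) (identityˡ x) (⊙⁺ A X e∈A x∈)
      avoid : ∀ {q} → q ∈ X → q ∉ (p ◃ H)
      avoid q∈ q∈pH with h , h∈ , refl ← ◃⁻ p H q∈pH =
        p∉ (subst (_∈ X) (//-rightDividesʳ h p) (H⁻ (H-⁻¹ h∈) q∈))

    shape : ∣ X ∣ ≡ 2 * ∣ H ∣ × N ≡ 3 * ∣ H ∣ × ∣ H ∣ + 4 ≤ 2 * ∣ A ∣ × ∣ A ∣ ≤ ∣ H ∣ + 1
    shape = two-cosets (∣H∣-divides X (λ x∈ h∈ → H⁻ h∈ x∈)) (∣H∣-divides (A ⊙ X) A⊙X-periodic)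
      where
      two-cosets : (∃ λ t → ∣ X ∣ ≡ t * ∣ H ∣) → (∃ λ u → N ≡ u * ∣ H ∣) → _
      two-cosets (t , X≡) (u , N≡) =
        parameters (∣ A ∣) (∣ X ∣) N (∣ H ∣) t u 3≤∣A∣ small 4-lines 3-translates ∣X∣+∣H∣≤ X≡ N≡

    -- If |H| = 2, the nontrivial element z of H is an involution, so that ax = bxz implies
    -- bx = axz, and the lines Ax and Axz are disjoint.
    ∣H∣≰2 : ¬ (∣ H ∣ ≤ 2)
    ∣H∣≰2 H≤2 = impossible shape (distinct₂ H 2≤H)
      where
      2≤H : 2 ≤ ∣ H ∣
      2≤H = ≤-pred (≤-trans 3≤∣A∣ (≤-trans (proj₂ (proj₂ (proj₂ shape))) (≤-reflexive (+-comm (∣ H ∣) 1))))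

      module _ {z : Fin n} (z∈H : z ∈ H) (z≢e : z ≢ e) where
        zz≡e : z · z ≡ e
        zz≡e with z · z ≟ e
        ... | yes eq = eq
        ... | no  ne = contradiction H≤2 (<⇒≱ (3≤∣∣ e∈H z∈H (H-· z∈H z∈H)
                         (z≢e ∘ sym) (ne ∘ sym) (x≢xz z≢e)))

        disjoint : ∀ x → ∣ (A ▹ x) ∩ (A ▹ (x · z)) ∣ ≤ 0
        disjoint x = ≤-reflexive (∣∣≡0 ((A ▹ x) ∩ (A ▹ (x · z))) none)
          where
          none : ∀ {p} → p ∉ ((A ▹ x) ∩ (A ▹ (x · z)))
          none p∈ with p∈x , p∈xz ← x∈p∩q⁻ (A ▹ x) (A ▹ (x · z)) p∈
            with a , a∈ , p≡ax ← ▹⁻ A x p∈x | b , b∈ , p≡bxz ← ▹⁻ A (x · z) p∈xz =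
            x≢xz z≢e (∙-cancelˡ b x (x · z)
              (trans (cong (_· x) (sym a≡b)) (trans (sym p≡ax) p≡bxz)))
            where
            open ≡-Reasoning
            bx≡axz : b · x ≡ a · (x · z)
            bx≡axz = sym (begin
              a · (x · z)       ≡⟨ sym (assoc a x z) ⟩
              a · x · z         ≡⟨ cong (_· z) (trans (sym p≡ax) p≡bxz) ⟩
              b · (x · z) · z   ≡⟨ assoc b (x · z) z ⟩
              b · (x · z · z)   ≡⟨ cong (b ·_) (trans (assoc x z z) (trans (cong (x ·_) zz≡e) (identityʳ x))) ⟩
              b · x             ∎)
            a≡b : a ≡ b
            a≡b = common-unique sidon (x≢xz z≢e) a∈ b∈ b∈ a∈ (trans (sym p≡ax) p≡bxz) bx≡axz

        3-lines-through-z : ∀ {x y} → x ∈ X → y ∈ X → y ≢ x → y ≢ x · z → 3 * ∣ A ∣ ≤ N + 2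
        3-lines-through-z {x} {y} x∈ y∈ y≢x y≢xz =
          times₃ (∣ A ∣) (∣Ax∣ x) (∣Ax∣ (x · z)) (∣Ax∣ y)
            (inclusion-exclusion₃ (A ▹ x) (A ▹ (x · z)) (A ▹ y) (A ⊙ X)
              (Ax⊆ x∈) (Ax⊆ (H⁻ z∈H x∈)) (Ax⊆ y∈)
              (disjoint x) (Ax∩Ay y≢x) (Ax∩Ay y≢xz))

        impossible-z : N ≡ 3 * ∣ H ∣ → ⊥
        impossible-z N≡ = absurd (fresh X [] (≤-trans (s≤s z≤n) 2≤∣X∣))
          where
          absurd : (∃ λ x → x ∈ X × All (x ≢_) []) → ⊥
          absurd (x , x∈ , _) with fresh X (x ∷ x · z ∷ []) 3≤∣X∣
          ... | y , y∈ , y≢x ∷ y≢xz ∷ [] = contradiction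
            (≤-trans (*-monoʳ-≤ 3 3≤∣A∣) (≤-trans (3-lines-through-z x∈ y∈ y≢x y≢xz)
              (+-monoˡ-≤ 2 (≤-trans (≤-reflexive N≡) (*-monoʳ-≤ 3 H≤2)))))
            (<⇒≱ (s≤s ≤-refl))

      impossible : _ → Distinct₂ H → ⊥
      impossible (_ , N≡ , _) (g , h , (g∈ , h∈) , h≢g) with g ≟ e
      ... | no g≢e   = impossible-z g∈ g≢e N≡
      ... | yes refl = impossible-z h∈ h≢g N≡

    -- Now |H| ≥ 3 gives |A| ≥ 4.  Any two of the sets xX with x ∈ A meet, and cover AX, because
    -- |xX| = 2|H|, |AX| = 3|H| and the intersection has at most |H| elements.  Hence a common
    -- point of two of them lies in one of two others.
    no-counterexample : ⊥
    no-counterexample = impossible shape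
      where
      impossible : _ → ⊥
      impossible (X≡ , N≡ , H+4≤2A , _) = absurd (distinct₄ A 4≤∣A∣)
        where
        h = ∣ H ∣
        4≤∣A∣ : 4 ≤ ∣ A ∣
        4≤∣A∣ = *-cancelˡ-< 2 3 (∣ A ∣) (≤-trans (+-monoˡ-≤ 4 (≰⇒> ∣H∣≰2)) H+4≤2A)

        cover : ∀ {x y} → x ∈ A → y ∈ A → y ≢ x → A ⊙ X ⊆ (x ◃ X) ∪ (y ◃ X)
        cover {x} {y} x∈ y∈ y≢x = ⊆∧∣∣≥⇒⊇ (∪-least (xX⊆ x∈) (xX⊆ y∈))
          (linear 0 (+-mono-≤ (≤-reflexive (sym (∣∪∣+∣∩∣ (x ◃ X) (y ◃ X)))) (+-mono-≤ (∣xX∩yX∣≤∣H∣ y≢x)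
              (+-mono-≤ (≤-reflexive (trans (sym X≡) (sym (∣◃∣ x X))))
                (+-mono-≤ (≤-reflexive (trans (sym X≡) (sym (∣◃∣ y X)))) (≤-reflexive N≡)))))
            (arith N h (∣ x ◃ X ∣) (∣ y ◃ X ∣) (∣ (x ◃ X) ∪ (y ◃ X) ∣) (∣ (x ◃ X) ∩ (y ◃ X) ∣)))
          where
          arith : ∀ N h p q u i → N + (u + i + (h + (p + (q + 3 * h)))) + 0 ≡ u + (p + q + (i + (2 * h + (2 * h + N))))
          arith = solve-∀

        meet : ∀ {x y} → x ∈ A → y ∈ A → 1 ≤ ∣ (x ◃ X) ∩ (y ◃ X) ∣
        meet {x} {y} x∈ y∈ = ≤-trans (1≤∣∣ e∈H)
          (linear 0 (+-mono-≤ (inclusion-exclusion₂ (x ◃ X) (y ◃ X) (A ⊙ X) (xX⊆ x∈) (xX⊆ y∈))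
             (+-mono-≤ (≤-reflexive N≡)
               (+-mono-≤ (≤-reflexive (trans (sym X≡) (sym (∣◃∣ x X)))) (≤-reflexive (trans (sym X≡) (sym (∣◃∣ y X)))))))
            (arith N h (∣ x ◃ X ∣) (∣ y ◃ X ∣) (∣ (x ◃ X) ∩ (y ◃ X) ∣)))
          where
          arith : ∀ N h p q i → h + (N + i + (3 * h + (p + q))) + 0 ≡ i + (p + q + (N + (2 * h + 2 * h)))
          arith = solve-∀

        -- zX is covered by its intersections with xX and yX, which would have the common point p.
        triple : ∀ {x y z p} → x ∈ A → y ∈ A → z ∈ A → y ≢ x → z ≢ x → z ≢ y →
          p ∈ (x ◃ X) → p ∈ (y ◃ X) → p ∈ (z ◃ X) → ⊥
        triple {x} {y} {z} {p} x∈ y∈ z∈ y≢x z≢x z≢y p∈x p∈y p∈z =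
          infeasible 0 bound (cong suc (trans (+-assoc h h 0) (trans (sym X≡) (sym (∣◃∣ z X)))))
          where
          P = (x ◃ X) ∩ (z ◃ X)
          Q = ((y ◃ X) ∩ (z ◃ X)) - p
          bound : suc ∣ z ◃ X ∣ ≤ h + h
          bound = ≤-trans (s≤s (cover-≤ P Q (z ◃ X) split))
            (≤-trans (≤-reflexive (sym (+-suc (∣ P ∣) (∣ Q ∣))))
              (+-mono-≤ (∣xX∩yX∣≤∣H∣ z≢x)
                (≤-trans (x∈p⇒∣p-x∣<∣p∣ (x∈p∩q⁺ (p∈y , p∈z))) (∣xX∩yX∣≤∣H∣ z≢y))))
            where
            split : ∀ {q} → q ∈ (z ◃ X) → q ∈ P ⊎ q ∈ Q
            split {q} q∈ with q ≟ p
            ... | yes refl = inj₁ (x∈p∩q⁺ (p∈x , q∈))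
            ... | no  q≢p with x∈p∪q⁻ (x ◃ X) (y ◃ X) (cover x∈ y∈ y≢x (xX⊆ z∈ q∈))
            ...   | inj₁ q∈x = inj₁ (x∈p∩q⁺ (q∈x , q∈))
            ...   | inj₂ q∈y = inj₂ (x∈p∧x≢y⇒x∈p-y (x∈p∩q⁺ (q∈y , q∈)) q≢p)

        absurd : Distinct₄ A → ⊥
        absurd (x , y , z , w , (x∈ , y∈ , z∈ , w∈) , y≢x , z≢x , z≢y , w≢x , w≢y , w≢z)
          with nonempty? ((x ◃ X) ∩ (y ◃ X))
        ... | no empty = contradiction
          (≤-trans (meet x∈ y∈) (≤-reflexive (∣∣≡0 ((x ◃ X) ∩ (y ◃ X)) (λ {p} p∈ → empty (p , p∈)))))
          λ ()
        ... | yes (p , p∈) with p∈x , p∈y ← x∈p∩q⁻ (x ◃ X) (y ◃ X) p∈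
          with x∈p∪q⁻ (z ◃ X) (w ◃ X) (cover z∈ w∈ w≢z (xX⊆ x∈ p∈x))
        ...   | inj₁ p∈z = triple x∈ y∈ z∈ y≢x z≢x z≢y p∈x p∈y p∈z
        ...   | inj₂ p∈w = triple x∈ y∈ w∈ y≢x w≢x w≢y p∈x p∈y p∈w

-- The lower bound for |AX| inside the generated subgroup

  large? : (A X : Subset n) → Dec (Large A X)
  large? A X = (∣ X ∣ + 2 * ∣ A ∣) ≤? (∣ A ⊙ X ∣ + 3)

  admissible⇒large : {W A X : Subset n} → Generating W A → 3 ≤ ∣ A ∣ → Admissible W A X → Large A X
  admissible⇒large {W} {A} {X} gen 3≤∣A∣ adm =
    go (∣ A ⊙ X ∣) n A X gen 3≤∣A∣ adm (∣p∣≤n X) (m≤n+m (∣ A ⊙ X ∣) (∣ X ∣))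
    where
    -- Induction on bounds f for |AX| - |X| and m for |X|, lexicographically.
    go : ∀ f m A X → Generating W A → 3 ≤ ∣ A ∣ → Admissible W A X →
         ∣ X ∣ ≤ m → ∣ A ⊙ X ∣ ≤ ∣ X ∣ + f → Large A X
    go f m A X gen 3≤∣A∣ adm X≤m AX≤ with large? A X
    ... | yes large = large
    ... | no ¬large = ⊥-elim (no-counterexample (record
      { generating   = gen
      ; 3≤∣A∣        = 3≤∣A∣
      ; admissible   = adm
      ; small        = small
      ; least-excess = λ X′ adm′ → least-excess f X′ adm′ AX≤
      ; least-size   = λ A′ X′ gen′ A′≡A adm′ le → least-size m A′ X′ gen′ A′≡A adm′ le X≤m
      }))
      where
      small : ∣ A ⊙ X ∣ + 4 ≤ ∣ X ∣ + 2 * ∣ A ∣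
      small = ≤-trans (≤-reflexive (+-suc (∣ A ⊙ X ∣) 3)) (≰⇒> ¬large)

      least-excess : ∀ f X′ → Admissible W A X′ → ∣ A ⊙ X ∣ ≤ ∣ X ∣ + f →
        ∣ A ⊙ X ∣ + ∣ X′ ∣ ≤ ∣ A ⊙ X′ ∣ + ∣ X ∣
      least-excess zero X′ adm′ AX≤ =
        linear 0 (+-mono-≤ AX≤ (∣Y∣≤∣X⊙Y∣ A X′ (Generating.e∈A gen)))
          (arith (∣ A ⊙ X ∣) (∣ X ∣) (∣ X′ ∣) (∣ A ⊙ X′ ∣))
        where
        arith : ∀ N b b′ N′ → N + b′ + (b + 0 + N′) + 0 ≡ N′ + b + (N + b′)
        arith = solve-∀
      least-excess (suc f) X′ adm′ AX≤ with (∣ A ⊙ X ∣ + ∣ X′ ∣) ≤? (∣ A ⊙ X′ ∣ + ∣ X ∣)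
      ... | yes le = le
      ... | no ¬le = ⊥-elim (infeasible 1
          (+-mono-≤ (go f n A X′ gen 3≤∣A∣ adm′ (∣p∣≤n X′) AX′≤) (+-mono-≤ small (≰⇒> ¬le)))
          (arith (∣ A ⊙ X ∣) (∣ X ∣) (∣ X′ ∣) (∣ A ⊙ X′ ∣) (∣ A ∣)))
        where
        AX′≤ : ∣ A ⊙ X′ ∣ ≤ ∣ X′ ∣ + f
        AX′≤ = linear 0 (+-mono-≤ (≰⇒> ¬le) AX≤) (arith′ (∣ A ⊙ X ∣) (∣ X ∣) (∣ X′ ∣) (∣ A ⊙ X′ ∣) f)
          where
          arith′ : ∀ N b b′ N′ f → N′ + (N + b′ + (b + suc f)) + 0 ≡ b′ + f + (suc (N′ + b) + N)
          arith′ = solve-∀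
        arith : ∀ N b b′ N′ a → suc (N′ + 3 + (b + 2 * a + (N + b′)) + 1) ≡
          b′ + 2 * a + (N + 4 + suc (N′ + b))
        arith = solve-∀

      least-size : ∀ m A′ X′ → Generating W A′ → ∣ A′ ∣ ≡ ∣ A ∣ → Admissible W A′ X′ →
        ∣ A′ ⊙ X′ ∣ + ∣ X ∣ ≤ ∣ A ⊙ X ∣ + ∣ X′ ∣ → ∣ X ∣ ≤ m → ∣ X ∣ ≤ ∣ X′ ∣
      least-size zero    A′ X′ gen′ A′≡A adm′ le X≤m = ≤-trans X≤m z≤n
      least-size (suc m) A′ X′ gen′ A′≡A adm′ le X≤m with ∣ X ∣ ≤? ∣ X′ ∣
      ... | yes X≤X′ = X≤X′
      ... | no  X≰X′ = ⊥-elim (infeasible 0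
          (+-mono-≤ (go f m A′ X′ gen′ (subst (3 ≤_) (sym A′≡A) 3≤∣A∣) adm′
                      (≤-pred (≤-trans (≰⇒> X≰X′) X≤m)) A′X′≤)
            (+-mono-≤ small le))
          (trans (arith (∣ A ⊙ X ∣) (∣ X ∣) (∣ X′ ∣) (∣ A′ ⊙ X′ ∣) (∣ A ∣))
            (cong (λ a → ∣ X′ ∣ + 2 * a + (∣ A ⊙ X ∣ + 4 + (∣ A′ ⊙ X′ ∣ + ∣ X ∣))) (sym A′≡A))))
        where
        A′X′≤ : ∣ A′ ⊙ X′ ∣ ≤ ∣ X′ ∣ + f
        A′X′≤ = linear 0 (+-mono-≤ le AX≤) (arith′ (∣ A ⊙ X ∣) (∣ X ∣) (∣ X′ ∣) (∣ A′ ⊙ X′ ∣) f)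
          where
          arith′ : ∀ N b b′ N′ f → N′ + (N + b′ + (b + f)) + 0 ≡ b′ + f + (N′ + b + N)
          arith′ = solve-∀
        arith : ∀ N b b′ N′ a → suc (N′ + 3 + (b + 2 * a + (N + b′)) + 0) ≡
          b′ + 2 * a + (N + 4 + (N′ + b))
        arith = solve-∀

-- Right cosets of the generated subgroup

  module _ {W A : Subset n} (gen : Generating W A) (3≤∣A∣ : 3 ≤ ∣ A ∣) where

    open Generating gen

    ∈-coset⁺ : ∀ {w s x} → w ∈ W → s ∈ (W ▹ x) → (w · s) ∈ (W ▹ x)
    ∈-coset⁺ {w} {s} {x} w∈ s∈ with v , v∈ , refl ← ▹⁻ W x s∈ =
      subst (_∈ (W ▹ x)) (assoc w v x) (▹⁺ W x (·-closed w∈ v∈))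

    ∈-coset⁻ : ∀ {w s x} → w ∈ W → (w · s) ∈ (W ▹ x) → s ∈ (W ▹ x)
    ∈-coset⁻ {w} {s} {x} w∈ ws∈ =
      subst (_∈ (W ▹ x)) (\\-leftDividesʳ w s) (∈-coset⁺ (⁻¹-closed w∈) ws∈)

    x∈Wx : ∀ x → x ∈ (W ▹ x)
    x∈Wx x = subst (_∈ (W ▹ x)) (identityˡ x) (▹⁺ W x e∈W)

    -- The core bound for subsets T of a coset W x, by translation to W.
    coset-large : ∀ {x} (T : Subset n) → T ⊆ W ▹ x → 2 ≤ ∣ T ∣ → ∣ A ⊙ T ∣ + 2 ≤ ∣ W ∣ → Large A T
    coset-large {x} T T⊆Wx 2≤∣T∣ room = ≤-trans
      (≤-reflexive (cong (_+ 2 * ∣ A ∣) (sym (∣▹∣ T (x ⁻¹)))))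
      (≤-trans (admissible⇒large gen 3≤∣A∣ (record
          { 2≤∣X∣ = ≤-trans 2≤∣T∣ (≤-reflexive (sym (∣▹∣ T (x ⁻¹))))
          ; X⊆W   = ▹-least T (x ⁻¹) into-W
          ; room  = ≤-trans (+-monoˡ-≤ 2 (∣X⊙Y▹g∣ A T (x ⁻¹))) room
          }))
        (+-monoˡ-≤ 3 (∣X⊙Y▹g∣ A T (x ⁻¹))))
      where
      into-W : ∀ {t} → t ∈ T → (t · x ⁻¹) ∈ W
      into-W t∈ = ∈-select⁻ (λ i → (i · x ⁻¹) ∈? W) (T⊆Wx t∈)

    -- The set A⁻¹ y is contained in W x and disjoint from T.
    missing-point : ∀ {x y} (T : Subset n) → T ⊆ W ▹ x → y ∈ (W ▹ x) → y ∉ (A ⊙ T) →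
      ∣ T ∣ + ∣ A ∣ ≤ ∣ W ∣
    missing-point {x} {y} T T⊆Wx y∈ y∉ = ≤-trans
      (≤-reflexive (cong (_+_ (∣ T ∣)) (sym (trans (∣▹∣ (A ⁻ˢ) y) (∣⁻ˢ∣ A)))))
      (≤-trans (disjoint-≤ T (A ⁻ˢ ▹ y) (W ▹ x) T⊆Wx
          (▹-least (A ⁻ˢ) y (λ b∈ → ∈-coset⁺ (Generating.A⊆W (generating-⁻ˢ gen) b∈) y∈)) avoid)
        (≤-reflexive (∣▹∣ W x)))
      where
      avoid : ∀ {t} → t ∈ T → t ∉ (A ⁻ˢ ▹ y)
      avoid t∈ t∈A⁻¹y with b , b∈ , refl ← ▹⁻ (A ⁻ˢ) y t∈A⁻¹y =
        y∉ (subst (_∈ (A ⊙ T)) (\\-leftDividesʳ b y) (⊙⁺ A T (⁻ˢ⁻ A b∈) t∈))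

    -- Whether |T| = 1, T is admissible, or AT misses a single element y of W x, the excess of
    -- T is at least |A| - 1.
    coset-excess : ∀ {x y} (T : Subset n) → T ⊆ W ▹ x → x ∈ T → y ∈ (W ▹ x) → y ∉ (A ⊙ T) →
      ∣ T ∣ + ∣ A ∣ ≤ ∣ A ⊙ T ∣ + 1
    coset-excess T T⊆Wx x∈ y∈ y∉ with 2 ≤? ∣ T ∣ | (∣ A ⊙ T ∣ + 2) ≤? ∣ W ∣
    ... | no 2≰∣T∣ | _ = ≤-trans
      (+-mono-≤ (≤-pred (≰⇒> 2≰∣T∣)) (∣X∣≤∣X⊙Y∣ A T x∈)) (≤-reflexive (+-comm 1 (∣ A ⊙ T ∣)))
    ... | yes 2≤∣T∣ | yes room = linear 1 (+-mono-≤ 3≤∣A∣ (coset-large T T⊆Wx 2≤∣T∣ room))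
      (arith (∣ T ∣) (∣ A ∣) (∣ A ⊙ T ∣))
      where
      arith : ∀ t a N → t + a + (a + (N + 3)) + 1 ≡ N + 1 + (3 + (t + 2 * a))
      arith = solve-∀
    ... | yes _ | no ¬room = ≤-trans (missing-point T T⊆Wx y∈ y∉)
      (≤-pred (≤-trans (≰⇒> ¬room) (≤-reflexive (+-suc (∣ A ⊙ T ∣) 1))))

    -- The parts of X inside and outside the coset W x.
    module Split (X : Subset n) (x : Fin n) where

      inner outer : Subset n
      inner = X ∩ (W ▹ x)
      outer = X ─ (W ▹ x)

      ∣inner∣+∣outer∣ : ∣ inner ∣ + ∣ outer ∣ ≡ ∣ X ∣
      ∣inner∣+∣outer∣ = split-∣∣ X (W ▹ x)

      inner⊆ : inner ⊆ W ▹ x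
      inner⊆ = p∩q⊆q X (W ▹ x)

      A⊙inner⊆ : A ⊙ inner ⊆ W ▹ x
      A⊙inner⊆ = ⊙-least A inner (λ a∈ s∈ → ∈-coset⁺ (A⊆W a∈) (inner⊆ s∈))

      ∣A⊙inner∣+∣A⊙outer∣ : ∣ A ⊙ inner ∣ + ∣ A ⊙ outer ∣ ≤ ∣ A ⊙ X ∣
      ∣A⊙inner∣+∣A⊙outer∣ = disjoint-≤ (A ⊙ inner) (A ⊙ outer) (A ⊙ X)
        (⊙-monoʳ A (p∩q⊆p X (W ▹ x))) (⊙-monoʳ A (p─q⊆p X (W ▹ x))) avoid
        where
        avoid : ∀ {y} → y ∈ (A ⊙ inner) → y ∉ (A ⊙ outer)
        avoid y∈ y∈outer with a , s , a∈ , s∈ , refl ← ⊙⁻ A outer y∈outer =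
          x∈p─q⇒x∉q X (W ▹ x) s∈ (∈-coset⁻ (A⊆W a∈) (A⊙inner⊆ y∈))

    -- If AX is not a union of right cosets of W, then |AX| - |X| ≥ |A| - 1.
    excess : ∀ {y} (X : Subset n) → y ∈ (W ⊙ X) → y ∉ (A ⊙ X) → ∣ X ∣ + ∣ A ∣ ≤ ∣ A ⊙ X ∣ + 1
    excess X y∈ y∉ with w , x , w∈ , x∈ , refl ← ⊙⁻ W X y∈ =
      linear 0 (+-mono-≤ (≤-reflexive (sym ∣inner∣+∣outer∣)) (+-mono-≤ inner-excess
          (+-mono-≤ (∣Y∣≤∣X⊙Y∣ A outer e∈A) ∣A⊙inner∣+∣A⊙outer∣)))
        (arith (∣ X ∣) (∣ A ∣) (∣ A ⊙ X ∣) (∣ inner ∣) (∣ outer ∣) (∣ A ⊙ inner ∣) (∣ A ⊙ outer ∣))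
      where
      open Split X x
      inner-excess : ∣ inner ∣ + ∣ A ∣ ≤ ∣ A ⊙ inner ∣ + 1
      inner-excess = coset-excess inner inner⊆ (x∈p∩q⁺ (x∈ , x∈Wx x)) (∈-coset⁺ w∈ (x∈Wx x))
        (λ wx∈ → y∉ (⊙-monoʳ A (p∩q⊆p X (W ▹ x)) wx∈))
      arith : ∀ X A AX i o Ai Ao → X + A + (i + o + (Ai + 1 + (Ao + AX))) + 0 ≡
        AX + 1 + (X + (i + A + (o + (Ai + Ao))))
      arith = solve-∀

-- The subgroup generated by a set

  -- The subgroup W generated by A, as a smallest set Y with 1 ∈ Y and AY ⊆ Y.
  module Generated (A : Subset n) (sidon : Sidon A) (e∈A : e ∈ A) where

    Closed : Subset n → Set
    Closed Y = e ∈ Y × A ⊙ Y ⊆ Y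

    private
      smallest : ∃ (IsMinimiser Closed ∣_∣)
      smallest = minimiser (λ Y → (e ∈? Y) ×-dec ((A ⊙ Y) ⊆? Y)) ∣_∣ (⊤ , ∈⊤ , λ _ → ∈⊤)

    W : Subset n
    W = proj₁ smallest

    private
      e∈W : e ∈ W
      e∈W = proj₁ (proj₁ (proj₂ smallest))

      AW⊆W : ∀ {a w} → a ∈ A → w ∈ W → (a · w) ∈ W
      AW⊆W a∈ w∈ = proj₂ (proj₁ (proj₂ smallest)) (⊙⁺ A W a∈ w∈)

      W-least : ∀ Y → e ∈ Y → (∀ {a y} → a ∈ A → y ∈ Y → (a · y) ∈ Y) → W ⊆ Y
      W-least Y e∈Y AY⊆Y w∈ = p∩q⊆q W Y (⊆∧∣∣≥⇒⊇ (p∩q⊆p W Y) (proj₂ (proj₂ smallest) (W ∩ Y) closed) w∈)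
        where
        closed : Closed (W ∩ Y)
        closed = x∈p∩q⁺ (e∈W , e∈Y) , ⊙-least A (W ∩ Y) (λ a∈ z∈ →
          let z∈W , z∈Y = x∈p∩q⁻ W Y z∈ in x∈p∩q⁺ (AW⊆W a∈ z∈W , AY⊆Y a∈ z∈Y))

      -- If Y is closed under A and contains y then it contains W y.
      Wy⊆ : ∀ (Y : Subset n) {y} → y ∈ Y → (∀ {a y} → a ∈ A → y ∈ Y → (a · y) ∈ Y) →
            ∀ {w} → w ∈ W → (w · y) ∈ Y
      Wy⊆ Y {y} y∈ AY⊆Y w∈ = ∈-select⁻ shifted (W-least (select shifted)
        (∈-select⁺ shifted (subst (_∈ Y) (sym (identityˡ y)) y∈))
        (λ {a} {v} a∈ v∈ → ∈-select⁺ shifted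
          (subst (_∈ Y) (sym (assoc a v y)) (AY⊆Y a∈ (∈-select⁻ shifted v∈))))
        w∈)
        where
        shifted : ∀ v → Dec ((v · y) ∈ Y)
        shifted v = (v · y) ∈? Y

      W·W⊆W : ∀ {x y} → x ∈ W → y ∈ W → (x · y) ∈ W
      W·W⊆W x∈ y∈ = Wy⊆ W y∈ AW⊆W x∈

    generating : Generating W A
    generating = record
      { sidon     = sidon
      ; e∈A       = e∈A
      ; A⊆W       = λ {a} a∈ → subst (_∈ W) (identityʳ a) (AW⊆W a∈ e∈W)
      ; ·-closed  = W·W⊆W
      ; ⁻¹-closed = λ {x} x∈ → subst (_∈ W) (identityˡ (x ⁻¹))
          (·g-closed⇒·g⁻¹-closed W (λ w∈ → W·W⊆W w∈ x∈) e∈W)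
      ; least     = λ Y {y} y∈ Y⊆W AY⊆Y → ⊆∧∣∣≥⇒⊇ Y⊆W
          (≤-trans (≤-reflexive (sym (∣▹∣ W y))) (p⊆q⇒∣p∣≤∣q∣ (▹-least W y (Wy⊆ Y y∈ AY⊆Y))))
      }

-- Aperiodic atoms

  -- A set A with the properties of a 2-atom of S with |A| ≥ 3 that is not left-periodic.  They
  -- are expressed by |XS| = |X| + |∂X|, and κ is the size of the boundary of A.
  record AperiodicAtom (S A : Subset n) (κ : ℕ) : Set where
    field
      3≤∣A∣     : 3 ≤ ∣ A ∣
      attained  : ∣ A ⊙ S ∣ ≡ ∣ A ∣ + κ
      minimal   : ∀ Y → 2 ≤ ∣ Y ∣ → ∣ Y ⊙ S ∣ + 2 ≤ n → ∣ Y ∣ + κ ≤ ∣ Y ⊙ S ∣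
      smallest  : ∀ Y → 2 ≤ ∣ Y ∣ → ∣ Y ⊙ S ∣ + 2 ≤ n → ∣ Y ⊙ S ∣ ≤ ∣ Y ∣ + κ → ∣ A ∣ ≤ ∣ Y ∣
      spacious  : 2 * ∣ A ∣ + κ ≤ n
      aperiodic : ∀ {g} → g ≢ e → ¬ (∀ {x} → x ∈ A → (g · x) ∈ A)

  atom-room : {S A : Subset n} {κ : ℕ} → AperiodicAtom S A κ → ∣ A ⊙ S ∣ + 3 ≤ n
  atom-room {S} {A} {κ} atom = linear 0 (+-mono-≤ (≤-reflexive attained) (+-mono-≤ 3≤∣A∣ spacious))
    (arith (∣ A ⊙ S ∣) (∣ A ∣) κ n)
    where
    open AperiodicAtom atom
    arith : ∀ N a κ n → N + 3 + (a + κ + (a + n)) + 0 ≡ n + (N + (3 + (2 * a + κ)))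
    arith = solve-∀

  translate-atom : {S A : Subset n} {κ : ℕ} → AperiodicAtom S A κ → (g : Fin n) → AperiodicAtom S (g ◃ A) κ
  translate-atom {S} {A} {κ} atom g = record
    { 3≤∣A∣     = subst (3 ≤_) (sym ∣B∣) 3≤∣A∣
    ; attained  = ≤-antisym
        (≤-trans (∣g◃X⊙Y∣ g A S) (≤-reflexive (trans attained (cong (_+ κ) (sym ∣B∣)))))
        (minimal (g ◃ A) (subst (2 ≤_) (sym ∣B∣) (≤-trans (s≤s (s≤s z≤n)) 3≤∣A∣)) room)
    ; minimal   = minimal
    ; smallest  = λ Y 2≤ room small → ≤-trans (≤-reflexive ∣B∣) (smallest Y 2≤ room small)
    ; spacious  = subst (λ a → 2 * a + κ ≤ n) (sym ∣B∣) spacious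
    ; aperiodic = λ h≢e hB⊆B → aperiodic (conjugate≢e h≢e) (conjugate-closed hB⊆B)
    }
    where
    open AperiodicAtom atom

    ∣B∣ : ∣ g ◃ A ∣ ≡ ∣ A ∣
    ∣B∣ = ∣◃∣ g A

    room : ∣ (g ◃ A) ⊙ S ∣ + 2 ≤ n
    room = ≤-trans (+-mono-≤ (∣g◃X⊙Y∣ g A S) (s≤s (s≤s z≤n))) (atom-room atom)

    conjugate≢e : ∀ {h} → h ≢ e → g ⁻¹ · h · g ≢ e
    conjugate≢e {h} h≢e eq = h≢e (∙-cancelˡ (g ⁻¹) h e (∙-cancelʳ g (g ⁻¹ · h) (g ⁻¹ · e)
      (trans eq (trans (sym (inverseˡ g)) (cong (_· g) (sym (identityʳ (g ⁻¹))))))))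

    conjugate-closed : ∀ {h} → (∀ {x} → x ∈ (g ◃ A) → (h · x) ∈ (g ◃ A)) →
                       ∀ {x} → x ∈ A → (g ⁻¹ · h · g · x) ∈ A
    conjugate-closed {h} hB⊆B {x} x∈ with y , y∈ , eq ← ◃⁻ g A (hB⊆B (◃⁺ g A x∈)) =
      subst (_∈ A) (sym (trans (assoc (g ⁻¹ · h) g x) (trans (assoc (g ⁻¹) h (g · x))
        (trans (cong (g ⁻¹ ·_) eq) (\\-leftDividesʳ g y))))) y∈

  module _ {S A : Subset n} {κ : ℕ} (atom : AperiodicAtom S A κ) (e∈A : e ∈ A) where

    open AperiodicAtom atom

    private
      room : ∣ A ⊙ S ∣ + 3 ≤ n
      room = atom-room atom

      ⊆-room : ∀ {Y} → Y ⊆ A → ∣ Y ⊙ S ∣ + 2 ≤ n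
      ⊆-room {Y} Y⊆A = ≤-trans (+-mono-≤ (p⊆q⇒∣p∣≤∣q∣ (⊙-monoˡ S Y⊆A)) (s≤s (s≤s z≤n))) room

    -- If A ∩ gA is a proper subset of A with at least two elements, then it is not a fragment, so
    -- that A ∪ gA has a boundary smaller than κ by submodularity.  The bound on |G| leaves two
    -- elements outside (A ∪ gA) S.
    atom-sidon : Sidon A
    atom-sidon {g} {u} {v} g≢e u∈ v∈ gu∈ gv∈ with u ≟ v
    ... | yes u≡v = u≡v
    ... | no  u≢v with ∣ A ∣ ≤? ∣ A ∩ (g ◃ A) ∣
    ...   | yes a≤∣I∣ = ⊥-elim (aperiodic g≢e (λ x∈ → Y⊆A (◃⁺ g A x∈)))
      where
      Y⊆A : g ◃ A ⊆ A
      Y⊆A = ⊆∧∣∣≥⇒⊇ (λ x∈ → p∩q⊆q A (g ◃ A) (⊆∧∣∣≥⇒⊇ (p∩q⊆p A (g ◃ A)) a≤∣I∣ x∈))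
        (≤-reflexive (∣◃∣ g A))
    ...   | no a≰∣I∣ = ⊥-elim (infeasible 0
        (+-mono-≤ (minimal U 2≤∣U∣ U-room) (+-mono-≤ ∣US∣+∣IS∣ (+-mono-≤ (≤-reflexive (sym ∣U∣+∣I∣)) I-larger)))
        (arith (∣ U ⊙ S ∣) (∣ I ⊙ S ∣) (∣ U ∣) (∣ I ∣) (∣ A ∣) κ))
      where
      Y = g ◃ A
      I = A ∩ Y
      U = A ∪ Y

      2≤∣I∣ : 2 ≤ ∣ I ∣
      2≤∣I∣ = 2≤∣∣ (x∈p∩q⁺ (gu∈ , ◃⁺ g A u∈)) (x∈p∩q⁺ (gv∈ , ◃⁺ g A v∈)) (u≢v ∘ ∙-cancelˡ g u v)

      2≤∣U∣ : 2 ≤ ∣ U ∣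
      2≤∣U∣ = ≤-trans (s≤s (s≤s z≤n)) (≤-trans 3≤∣A∣ (∣p∣≤∣p∪q∣ A Y))

      I-larger : ∣ I ∣ + κ < ∣ I ⊙ S ∣
      I-larger = ≰⇒> (λ le → a≰∣I∣ (smallest I 2≤∣I∣ (⊆-room (p∩q⊆p A Y)) le))

      ∣US∣+∣IS∣ : ∣ U ⊙ S ∣ + ∣ I ⊙ S ∣ ≤ (∣ A ∣ + κ) + (∣ A ∣ + κ)
      ∣US∣+∣IS∣ = ≤-trans (submodularˡ A Y S)
        (+-mono-≤ (≤-reflexive attained) (≤-trans (∣g◃X⊙Y∣ g A S) (≤-reflexive attained)))

      ∣U∣+∣I∣ : ∣ U ∣ + ∣ I ∣ ≡ ∣ A ∣ + ∣ A ∣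
      ∣U∣+∣I∣ = trans (∣∪∣+∣∩∣ A Y) (cong (_+_ (∣ A ∣)) (∣◃∣ g A))

      U-room : ∣ U ⊙ S ∣ + 2 ≤ n
      U-room = linear 1 (+-mono-≤ ∣US∣+∣IS∣ (+-mono-≤ I-larger (+-mono-≤ 2≤∣I∣ spacious)))
        (arith₁ (∣ U ⊙ S ∣) (∣ I ⊙ S ∣) (∣ I ∣) (∣ A ∣) κ n)
        where
        arith₁ : ∀ US IS I a κ n → US + 2 + (a + κ + (a + κ) + (IS + (I + n))) + 1 ≡
          n + (US + IS + (suc (I + κ) + (2 + (2 * a + κ))))
        arith₁ = solve-∀

      arith : ∀ US IS U I a κ → suc (US + (a + κ + (a + κ) + (U + I + IS)) + 0) ≡
        U + κ + (US + IS + (a + a + suc (I + κ)))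
      arith = solve-∀

    -- The set A without 1 is not a fragment, so (A without 1) S is not smaller than AS and contains
    -- every s = 1 s of S.
    second-representation : ∀ {s} → s ∈ S → ∃ λ b → ∃ λ s′ → b ∈ A × s′ ∈ S × s′ ≢ s × b · s′ ≡ s
    second-representation {s} s∈ with s ∈? ((A - e) ⊙ S)
    ... | yes s∈A′S with b , s′ , b∈ , s′∈ , s≡bs′ ← ⊙⁻ (A - e) S s∈A′S =
      b , s′ , p─q⊆p A ⁅ e ⁆ b∈ , s′∈ , s′≢s , sym s≡bs′
      where
      s′≢s : s′ ≢ s
      s′≢s refl = x∈p─q⇒x∉q A ⁅ e ⁆ b∈ (subst (_∈ ⁅ e ⁆)
        (∙-cancelʳ s′ e b (trans (identityˡ s′) s≡bs′)) (x∈⁅x⁆ e))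
    ... | no s∉A′S = ⊥-elim (<⇒≱ (x∈p⇒∣p-x∣<∣p∣ e∈A) (smallest (A - e) 2≤∣A-e∣ (⊆-room (p─q⊆p A ⁅ e ⁆)) small))
      where
      2≤∣A-e∣ : 2 ≤ ∣ A - e ∣
      2≤∣A-e∣ = ≤-pred (≤-trans 3≤∣A∣ (∣p∣≤1+∣p-x∣ A e))
      small : ∣ (A - e) ⊙ S ∣ ≤ ∣ A - e ∣ + κ
      small = ≤-pred (≤-trans
        (p⊂q⇒∣p∣<∣q∣ (⊙-monoˡ S (p─q⊆p A ⁅ e ⁆) , s , subst (_∈ (A ⊙ S)) (identityˡ s) (⊙⁺ A S e∈A s∈) , s∉A′S))
        (≤-trans (≤-reflexive attained) (+-monoˡ-≤ κ (∣p∣≤1+∣p-x∣ A e))))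

    atom-large : Large A S
    atom-large with ⊆-or-∃ (W ⊙ S) (A ⊙ S)
      where open Generated A atom-sidon e∈A
    -- Here W = A, since |W| + κ ≤ |WS| ≤ a + κ.
    ... | inj₁ WS⊆AS = ⊥-elim (periodic (distinct₂ A (≤-trans (s≤s (s≤s z≤n)) 3≤∣A∣)))
      where
      open Generated A atom-sidon e∈A
      open Generating generating using (A⊆W; ·-closed)
      ∣A∣≤∣W∣ : ∣ A ∣ ≤ ∣ W ∣
      ∣A∣≤∣W∣ = p⊆q⇒∣p∣≤∣q∣ A⊆W
      ∣WS∣≤∣AS∣ : ∣ W ⊙ S ∣ ≤ ∣ A ⊙ S ∣
      ∣WS∣≤∣AS∣ = p⊆q⇒∣p∣≤∣q∣ WS⊆AS
      ∣W∣≤∣A∣ : ∣ W ∣ ≤ ∣ A ∣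
      ∣W∣≤∣A∣ = +-cancelʳ-≤ κ (∣ W ∣) (∣ A ∣) (≤-trans
        (minimal W (≤-trans (s≤s (s≤s z≤n)) (≤-trans 3≤∣A∣ ∣A∣≤∣W∣))
          (≤-trans (+-mono-≤ ∣WS∣≤∣AS∣ (s≤s (s≤s z≤n))) room))
        (≤-trans ∣WS∣≤∣AS∣ (≤-reflexive attained)))
      W⊆A : W ⊆ A
      W⊆A = ⊆∧∣∣≥⇒⊇ A⊆W ∣W∣≤∣A∣
      A-closed : ∀ {g} → g ∈ A → ∀ {x} → x ∈ A → (g · x) ∈ A
      A-closed g∈ x∈ = W⊆A (·-closed (A⊆W g∈) (A⊆W x∈))
      periodic : Distinct₂ A → ⊥
      periodic (g , h , (g∈ , h∈) , h≢g) with g ≟ e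
      ... | no  g≢e  = aperiodic g≢e (A-closed g∈)
      ... | yes refl = aperiodic h≢g (A-closed h∈)
    ... | inj₂ (y , y∈WS , y∉AS) with w , x , w∈ , x∈ , refl ← ⊙⁻ (Generated.W A atom-sidon e∈A) S y∈WS =
      by-cases (((∣ A ⊙ inner ∣ + 2) ≤? ∣ W ∣)) (⊆-or-∃ (W ⊙ outer) (A ⊙ outer))
      where
      open Generated A atom-sidon e∈A
      open Generating generating using (A⊆W; ⁻¹-closed)
      open Split generating 3≤∣A∣ S x

      wx∈Wx : (w · x) ∈ (W ▹ x)
      wx∈Wx = ▹⁺ W x w∈

      x∈inner : x ∈ inner
      x∈inner = x∈p∩q⁺ (x∈ , x∈Wx generating 3≤∣A∣ x)

      y∉A⊙inner : (w · x) ∉ (A ⊙ inner)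
      y∉A⊙inner y∈ = y∉AS (⊙-monoʳ A (p∩q⊆p S (W ▹ x)) y∈)

      2≤∣inner∣ : 2 ≤ ∣ inner ∣
      2≤∣inner∣ with b , s , b∈ , s∈ , s≢x , bs≡x ← second-representation x∈ =
        2≤∣∣ x∈inner (x∈p∩q⁺ (s∈ , s∈Wx)) (s≢x ∘ sym)
        where
        s∈Wx : s ∈ (W ▹ x)
        s∈Wx = ∈-coset⁻ generating 3≤∣A∣ (A⊆W b∈)
          (subst (_∈ (W ▹ x)) (sym bs≡x) (x∈Wx generating 3≤∣A∣ x))

      inner+A≤W : ∣ inner ∣ + ∣ A ∣ ≤ ∣ W ∣
      inner+A≤W = missing-point generating 3≤∣A∣ inner inner⊆ wx∈Wx y∉A⊙inner

      by-cases : Dec (∣ A ⊙ inner ∣ + 2 ≤ ∣ W ∣) →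
        (W ⊙ outer ⊆ A ⊙ outer ⊎ (∃ λ z → z ∈ (W ⊙ outer) × z ∉ (A ⊙ outer))) → Large A S
      -- The core bound applies to S ∩ W x, and A does not shrink the rest of S.
      by-cases (yes inner-room) _ =
        linear 0 (+-mono-≤ (≤-reflexive (sym ∣inner∣+∣outer∣))
            (+-mono-≤ (coset-large generating 3≤∣A∣ inner inner⊆ 2≤∣inner∣ inner-room)
              (+-mono-≤ (∣Y∣≤∣X⊙Y∣ A outer e∈A) ∣A⊙inner∣+∣A⊙outer∣)))
          (arith (∣ S ∣) (∣ A ∣) (∣ A ⊙ S ∣) (∣ inner ∣) (∣ outer ∣) (∣ A ⊙ inner ∣) (∣ A ⊙ outer ∣))
        where
        arith : ∀ s a N i o Ai Ao → s + 2 * a + (i + o + (Ai + 3 + (Ao + N))) + 0 ≡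
          N + 3 + (s + (i + 2 * a + (o + (Ai + Ao))))
        arith = solve-∀
      -- Both parts of S have excess at least a - 1, and 2a - 2 ≥ 2a - 3.
      by-cases (no _) (inj₂ (z , z∈ , z∉)) =
        linear 1 (+-mono-≤ (≤-reflexive (sym ∣inner∣+∣outer∣))
            (+-mono-≤ (coset-excess generating 3≤∣A∣ inner inner⊆ x∈inner wx∈Wx y∉A⊙inner)
              (+-mono-≤ (excess generating 3≤∣A∣ outer z∈ z∉) ∣A⊙inner∣+∣A⊙outer∣)))
          (arith (∣ S ∣) (∣ A ∣) (∣ A ⊙ S ∣) (∣ inner ∣) (∣ outer ∣) (∣ A ⊙ inner ∣) (∣ A ⊙ outer ∣))
        where
        arith : ∀ s a N i o Ai Ao → s + 2 * a + (i + o + (Ai + 1 + (Ao + 1 + N))) + 1 ≡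
          N + 3 + (s + (i + a + (o + a + (Ai + Ao))))
        arith = solve-∀
      -- WS exceeds AS by at most one element, so that |W| ≤ a + 1, while |W| ≥ |S ∩ W x| + a ≥ a + 2.
      by-cases (no ¬inner-room) (inj₁ W⊙outer⊆) = ⊥-elim (infeasible 0
          (+-mono-≤ 2≤∣inner∣ (+-mono-≤ inner+A≤W (+-mono-≤ (minimal W 2≤∣W∣ W-room)
            (+-mono-≤ ∣WS∣≤ (≤-reflexive attained)))))
          (arith (∣ inner ∣) (∣ A ∣) (∣ W ∣) κ (∣ W ⊙ S ∣) (∣ A ⊙ S ∣)))
        where
        ∣W∣≤ : ∣ W ∣ ≤ ∣ A ⊙ inner ∣ + 1
        ∣W∣≤ = ≤-pred (≤-trans (≰⇒> ¬inner-room) (≤-reflexive (+-suc (∣ A ⊙ inner ∣) 1)))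

        2≤∣W∣ : 2 ≤ ∣ W ∣
        2≤∣W∣ = ≤-trans (s≤s (s≤s z≤n)) (≤-trans 3≤∣A∣ (p⊆q⇒∣p∣≤∣q∣ A⊆W))

        split : ∀ {z} → z ∈ (W ⊙ S) → z ∈ (W ▹ x) ⊎ z ∈ (A ⊙ outer)
        split {z} z∈ with z ∈? (W ▹ x)
        ... | yes z∈Wx = inj₁ z∈Wx
        ... | no  z∉Wx with v , s , v∈ , s∈ , refl ← ⊙⁻ W S z∈ =
          inj₂ (W⊙outer⊆ (⊙⁺ W outer v∈
            (x∈p∧x∉q⇒x∈p─q s∈ (λ s∈Wx → z∉Wx (∈-coset⁺ generating 3≤∣A∣ v∈ s∈Wx)))))

        ∣WS∣≤ : ∣ W ⊙ S ∣ ≤ ∣ A ⊙ S ∣ + 1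
        ∣WS∣≤ = linear 0 (+-mono-≤ (cover-≤ (W ▹ x) (A ⊙ outer) (W ⊙ S) split)
            (+-mono-≤ (≤-reflexive (∣▹∣ W x)) (+-mono-≤ ∣W∣≤ ∣A⊙inner∣+∣A⊙outer∣)))
          (arith₁ (∣ W ⊙ S ∣) (∣ A ⊙ S ∣) (∣ W ▹ x ∣) (∣ W ∣) (∣ A ⊙ inner ∣) (∣ A ⊙ outer ∣))
          where
          arith₁ : ∀ WS AS Wx W Ai Ao → WS + (Wx + Ao + (W + (Ai + 1 + AS))) + 0 ≡
            AS + 1 + (WS + (Wx + (W + (Ai + Ao))))
          arith₁ = solve-∀

        W-room : ∣ W ⊙ S ∣ + 2 ≤ n
        W-room = ≤-trans (+-monoˡ-≤ 2 ∣WS∣≤) (≤-trans (≤-reflexive (+-assoc (∣ A ⊙ S ∣) 1 2)) room)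

        arith : ∀ i a W κ WS AS → suc (i + (W + (WS + (AS + 1 + (a + κ)))) + 0) ≡
          2 + (i + a + (W + κ + (WS + AS)))
        arith = solve-∀

  atom-bound : {S A : Subset n} {κ : ℕ} → AperiodicAtom S A κ → ∣ A ∣ + ∣ S ∣ ≤ κ + 3
  atom-bound {S} {A} {κ} atom = bound (fresh A [] (≤-trans (s≤s z≤n) (AperiodicAtom.3≤∣A∣ atom)))
    where
    bound : (∃ λ a → a ∈ A × All (a ≢_) []) → ∣ A ∣ + ∣ S ∣ ≤ κ + 3
    bound (a , a∈ , _) = subst (λ m → m + ∣ S ∣ ≤ κ + 3) (∣◃∣ (a ⁻¹) A)
      (linear 0 (+-mono-≤ (atom-large B-atom e∈B) (≤-reflexive (AperiodicAtom.attained B-atom)))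
        (arith (∣ B ∣) (∣ S ∣) κ (∣ B ⊙ S ∣)))
      where
      B = (a ⁻¹) ◃ A
      B-atom : AperiodicAtom S B κ
      B-atom = translate-atom atom (a ⁻¹)
      e∈B : e ∈ B
      e∈B = subst (_∈ B) (inverseˡ a) (◃⁺ (a ⁻¹) A a∈)
      arith : ∀ b s k BS → b + s + (BS + 3 + (b + k)) + 0 ≡ k + 3 + (s + 2 * b + BS)
      arith = solve-∀

-- Two-atoms of a finite group

-- The group law of G carried over to the indices of its elements.
finGroup : ∀ {c ℓ} (G : FiniteGroup c ℓ) → FinGroup (FiniteGroup.order G)
finGroup G = record
  { _·_     = λ i j → index (element i ∙ element j)
  ; e       = index ε
  ; _⁻¹     = λ i → index (element i ⁻¹)
  ; isGroup = record
    { isMonoid = record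
      { isSemigroup = record
        { isMagma = record { isEquivalence = isEquivalence ; ∙-cong = cong₂ (λ i j → index (element i ∙ element j)) }
        ; assoc = λ i j k → index-cong (G.trans (∙-congʳ (element∘index _))
            (G.trans (G.assoc _ _ _) (∙-congˡ (G.sym (element∘index _)))))
        }
      ; identity =
          (λ i → trans (index-cong (G.trans (∙-congʳ (element∘index ε)) (G.identityˡ _))) (index∘element i))
        , (λ i → trans (index-cong (G.trans (∙-congˡ (element∘index ε)) (G.identityʳ _))) (index∘element i))
      }
    ; inverse =
        (λ i → index-cong (G.trans (∙-congʳ (element∘index _)) (G.inverseˡ _)))
      , (λ i → index-cong (G.trans (∙-congˡ (element∘index _)) (G.inverseʳ _)))
    ; ⁻¹-cong = cong (λ i → index (element i ⁻¹))
    }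
  }
  where
  module G = FiniteGroup G
  open FiniteGroup G using (index; element; _∙_; ε; _⁻¹; enumeration; ∙-congˡ; ∙-congʳ)
  open Inverse enumeration using () renaming
    (to-cong to index-cong; strictlyInverseˡ to index∘element; strictlyInverseʳ to element∘index)

minimum-≤ : ∀ {n} {P : Subset n → Set} (f : Subset n → ℕ) (X : Subset n) → (∀ Y → P Y → f X ≤ f Y) →
            (m : ∃ (IsMinimiser P f)) → f X ≤ f (proj₁ m)
minimum-≤ _ _ X-min (Y , PY , _) = X-min Y PY

≤-minimum : ∀ {n} {P : Subset n → Set} (f : Subset n → ℕ) (X : Subset n) →
            (m : ∃ (IsMinimiser P f)) → P X → f (proj₁ m) ≤ f X
≤-minimum _ _ (_ , _ , Y-min) PX = Y-min _ PX

spacious-A : ∀ a α κ {n} → a ≤ α → n ≥ 2 * α + κ → 2 * a + κ ≤ n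
spacious-A a α κ a≤α = ≤-trans (+-monoˡ-≤ κ (*-monoʳ-≤ 2 a≤α))

module _ {c ℓ : Level} (G : FiniteGroup c ℓ) where

  open FiniteGroup G using (order; index; element; ε; _≈_; enumeration)

  private
    𝒢 : FinGroup order
    𝒢 = finGroup G

    infixl 8 _⊡_
    -- This product set is productSet G by definition.
    _⊡_ : Subset order → Subset order → Subset order
    _⊡_ = _⊙_ 𝒢

  open FinGroup 𝒢 using (_·_; e; identityʳ; ∙-cancelˡ)

  -- A set mapped into itself by the translation by k ≠ 1 is left-periodic.
  closed⇒periodic : (A : Subset order) {k : Fin order} → k ≢ e →
    (∀ {x} → x ∈ A → (k · x) ∈ A) → LeftPeriodic G A
  closed⇒periodic A {k} k≢e kA⊆A = element k , k≉ε , ⊆-antisym kA⊆ (⊆∧∣∣≥⇒⊇ kA⊆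
    (∣∣-injective-≤ A (leftTranslate G (element k) A) (k ·_)
      (λ {i} i∈ → ∈-select⁺ translate? (i , i∈ , refl)) (∙-cancelˡ k _ _)))
    where
    k≉ε : ¬ (element k ≈ ε)
    k≉ε k≈ε = k≢e (trans (sym (Inverse.strictlyInverseˡ enumeration k)) (Inverse.to-cong enumeration k≈ε))
    translate? : (g : Fin order) → Dec (∃ λ i → i ∈ A × g ≡ k · i)
    translate? g = any? λ i → (i ∈? A) ×-dec (g ≟ (k · i))
    kA⊆ : leftTranslate G (element k) A ⊆ A
    kA⊆ g∈ with _ , i∈ , refl ← ∈-select⁻ translate? g∈ = kA⊆A i∈

  module _ (S : Subset order) (e∈S : e ∈ S) where

    X⊆XS : (X : Subset order) → X ⊆ X ⊡ S
    X⊆XS X {x} x∈ = subst (_∈ (X ⊡ S)) (identityʳ x) (⊙⁺ 𝒢 X S x∈ e∈S)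

    ∣X∣+∣∂X∣ : (X : Subset order) → ∣ X ∣ + ∣ ∂ G S X ∣ ≡ ∣ X ⊡ S ∣
    ∣X∣+∣∂X∣ X = ∣─∣ (X ⊡ S) X (X⊆XS X)

    ∣X*∣+∣XS∣ : (X : Subset order) → ∣ exterior G S X ∣ + ∣ X ⊡ S ∣ ≡ order
    ∣X*∣+∣XS∣ X = trans (cong (_+ ∣ X ⊡ S ∣) (trans (cong (λ Y → ∣ ∁ Y ∣) X∪∂X≡XS) (∣∁p∣≡n∸∣p∣ (X ⊡ S))))
      (m∸n+n≡m (∣p∣≤n (X ⊡ S)))
      where
      covers : X ⊡ S ⊆ X ∪ ∂ G S X
      covers {y} y∈ with y ∈? X
      ... | yes y∈X = x∈p∪q⁺ (inj₁ y∈X)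
      ... | no  y∉X = x∈p∪q⁺ (inj₂ (x∈p∧x∉q⇒x∈p─q y∈ y∉X))
      X∪∂X≡XS : X ∪ ∂ G S X ≡ X ⊡ S
      X∪∂X≡XS = ⊆-antisym (∪-least (X⊆XS X) (p─q⊆p (X ⊡ S) X)) covers

    separates⁺ : (X : Subset order) → 2 ≤ ∣ X ∣ → ∣ X ⊡ S ∣ + 2 ≤ order → Separates G 2 S X
    separates⁺ X 2≤ room = 2≤ , +-cancelʳ-≤ (∣ X ⊡ S ∣) 2 _
      (≤-trans (≤-reflexive (+-comm 2 (∣ X ⊡ S ∣))) (≤-trans room (≤-reflexive (sym (∣X*∣+∣XS∣ X)))))

    aperiodicAtom : (sep : Separable G 2 S) → order ≥ 2 * α G 2 S sep + κ G 2 S sep →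
      (A : Subset order) → IsAtom G 2 S sep A → ∣ A ∣ ≥ 3 → ¬ LeftPeriodic G A →
      AperiodicAtom 𝒢 S A (κ G 2 S sep)
    aperiodicAtom sep spacious A ((A-separates , ∂A≡κ) , A-smallest) 3≤∣A∣ ¬periodic = record
      { 3≤∣A∣     = 3≤∣A∣
      ; attained  = trans (sym (∣X∣+∣∂X∣ A)) (cong (_+_ (∣ A ∣)) ∂A≡κ)
      ; minimal   = λ Y 2≤ room → ≤-trans (+-monoʳ-≤ (∣ Y ∣) (κ≤ Y 2≤ room)) (≤-reflexive (∣X∣+∣∂X∣ Y))
      ; smallest  = λ Y 2≤ room small → A-smallest Y (separates⁺ Y 2≤ room , ≤-antisym
            (+-cancelˡ-≤ (∣ Y ∣) _ _ (≤-trans (≤-reflexive (∣X∣+∣∂X∣ Y)) small)) (κ≤ Y 2≤ room))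
      ; spacious  = spacious-A (∣ A ∣) (α G 2 S sep) (κ G 2 S sep) A≤α spacious
      ; aperiodic = λ g≢e gA⊆A → ¬periodic (closed⇒periodic A g≢e gA⊆A)
      }
      where
      A≤α : ∣ A ∣ ≤ α G 2 S sep
      A≤α = minimum-≤ ∣_∣ A A-smallest (atom G 2 S sep)

      κ≤ : ∀ Y → 2 ≤ ∣ Y ∣ → ∣ Y ⊡ S ∣ + 2 ≤ order → κ G 2 S sep ≤ ∣ ∂ G S Y ∣
      κ≤ Y 2≤ room = ≤-minimum (λ X → ∣ ∂ G S X ∣) Y (∂-minimiser G 2 S sep) (separates⁺ Y 2≤ room)

a+s≤k+3⇒a≤k-s+3 : ∀ a s k → a + s ≤ k + 3 → + a ℤ.≤ + k ℤ.- + s ℤ.+ + 3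
a+s≤k+3⇒a≤k-s+3 a s k le = ℤ.≤-trans (ℤ.≤-reflexive (sym cancel))
  (ℤ.≤-trans (ℤ.+-monoˡ-≤ (ℤ.- (+ s)) (ℤ.+≤+ le)) (ℤ.≤-reflexive swap))
  where
  cancel : + (a + s) ℤ.- + s ≡ + a
  cancel = trans (ℤ.+-assoc (+ a) (+ s) (ℤ.- (+ s)))
    (trans (cong (λ i → (+ a) ℤ.+ i) (ℤ.+-inverseʳ (+ s))) (ℤ.+-identityʳ (+ a)))
  swap : + (k + 3) ℤ.- + s ≡ + k ℤ.- + s ℤ.+ + 3
  swap = trans (ℤ.+-assoc (+ k) (+ 3) (ℤ.- (+ s)))
    (trans (cong (λ i → (+ k) ℤ.+ i) (ℤ.+-comm (+ 3) (ℤ.- (+ s)))) (sym (ℤ.+-assoc (+ k) (ℤ.- (+ s)) (+ 3))))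

proposition10 : ∀ {c ℓ : Level} (G : FiniteGroup c ℓ) (S : GSubset G) →
    (sep : Separable G 2 S) →
    Generates G S →
    _∈ᴳ_ G (FiniteGroup.ε G) S →
    ∣ S ∣ ≥ 3 →
    FiniteGroup.order G ≥ 2 * α G 2 S sep + κ G 2 S sep →
    (A : GSubset G) → IsAtom G 2 S sep A →
    ∣ A ∣ ≥ 3 →
    ¬ LeftPeriodic G A →
    + ∣ A ∣ ℤ.≤ + κ G 2 S sep ℤ.- + ∣ S ∣ ℤ.+ + 3
proposition10 G S sep _ ε∈S _ spacious A A-atom 3≤∣A∣ ¬periodic =
  a+s≤k+3⇒a≤k-s+3 (∣ A ∣) (∣ S ∣) (κ G 2 S sep)
    (atom-bound (finGroup G) (aperiodicAtom G S ε∈S sep spacious A A-atom 3≤∣A∣ ¬periodic))
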